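{- Let $G$ be a connected finite simple graph of order $n$. Then \[A(G) \geq \frac{n+2}{3},\] with equality if and only if $G$ is a path. In particular, $D(G) = A(G)/n > 1/3$ for every connected graph $G$.
   Context: For a connected finite simple graph $G$ with vertex set $V$, a subset $U\subseteq V$ is a connected set if the subgraph of $G$ induced by $U$ is connected. Let $\mathcal C(G)$ be the collection of all nonempty connected sets of $G$, $N(G)=|\mathcal C(G)|$, $S(G)=\sum_{U\in\mathcal C(G)}|U|$, and $A(G)=S(G)/N(G)$ (the average size of a nonempty connected set). The density is $D(G)=A(G)/n$. -}

module Defs where

open import Data.Nat using (ℕ; zero; suc; _+_; _*_)
open import Data.Bool using (Bool; true; false)
open import Data.Fin using (Fin; toℕ)
open import Data.Fin.Subset using (Subset; _∈_; Nonempty; ∣_∣; ⊤)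
open import Data.Fin.Permutation using (Permutation′; _⟨$⟩ʳ_)
open import Data.Vec using (Vec; []; _∷_)
open import Data.List using (List; []; _∷_; _++_; map; filter; length)
open import Data.Nat.ListAction using (sum)
open import Data.Sum using (_⊎_)
open import Data.Product using (∃; _×_)
open import Relation.Binary.PropositionalEquality using (_≡_)
open import Relation.Nullary using (¬_; Dec)
open import Function.Bundles using (_⇔_)

record Graph (n : ℕ) : Set where
  field
    adj   : Fin n → Fin n → Bool
    sym   : ∀ u v → adj u v ≡ adj v u
    irrefl : ∀ v → adj v v ≡ false
open Graph public

Adjacent : ∀ {n} → Graph n → Fin n → Fin n → Set
Adjacent G u v = adj G u v ≡ true

data WalkIn {n} (G : Graph n) (U : Subset n) : Fin n → Fin n → Set where
  here : ∀ {v} → v ∈ U → WalkIn G U v v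
  step : ∀ {u w v} → u ∈ U → Adjacent G u w → WalkIn G U w v → WalkIn G U u v

-- The subgraph induced by U is connected (the empty graph is counted
-- as connected here; nonemptiness is imposed separately).
InducedConnected : ∀ {n} → Graph n → Subset n → Set
InducedConnected G U = ∀ u v → u ∈ U → v ∈ U → WalkIn G U u v

ConnectedSet : ∀ {n} → Graph n → Subset n → Set
ConnectedSet G U = Nonempty U × InducedConnected G U

Connected : ∀ {n} → Graph n → Set
Connected G = ConnectedSet G ⊤

allSubsets : (n : ℕ) → List (Subset n)
allSubsets zero = [] ∷ []
allSubsets (suc n) = map (true ∷_) (allSubsets n) ++ map (false ∷_) (allSubsets n)

-- 𝒞(G) as a list, given a decision procedure for connected sets
-- (the resulting list does not depend on the choice of decider).
connectedSets : ∀ {n} (G : Graph n) → (∀ U → Dec (ConnectedSet G U)) → List (Subset n)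
connectedSets {n} G dec = filter dec (allSubsets n)

Nc : ∀ {n} (G : Graph n) → (∀ U → Dec (ConnectedSet G U)) → ℕ
Nc G dec = length (connectedSets G dec)

Sc : ∀ {n} (G : Graph n) → (∀ U → Dec (ConnectedSet G U)) → ℕ
Sc G dec = sum (map ∣_∣ (connectedSets G dec))

IsPath : ∀ {n} → Graph n → Set
IsPath {n} G = ∃ λ (σ : Permutation′ n) → ∀ u v →
  Adjacent G u v ⇔ (suc (toℕ (σ ⟨$⟩ʳ u)) ≡ toℕ (σ ⟨$⟩ʳ v) ⊎ suc (toℕ (σ ⟨$⟩ʳ v)) ≡ toℕ (σ ⟨$⟩ʳ u))

{-# OPTIONS --safe #-}

-- Counting pairs (U , v) with U connected and v outside U, the claim (n + 2) N ≤ 3 S reads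
-- Σ (n − |U|) + 2 N ≤ 2 S. Join v to U by a shortest path, ending in a vertex w adjacent to U, and
-- let H be the union of U and this path. Then U is a component of H − w, and the rest of H − w is
-- the remainder of the path; so (H , w) determines (U , v) up to a choice between two components.
-- This uses at most 2 |H| slots per H, and two of them stay free for the summand 2 N, because H has
-- two vertices w with H − w connected (or is a single vertex, reached by no pair).
-- In case of equality all slots for H = G are used. A vertex w with both slots used by pairs splits
-- G into two paths, so all degrees are at most two and some degree is at most one: G is a path.
-- Conversely, on a path the pair (H , w) cuts off the part of the interval H on either side of w,
-- which gives an injection in the opposite direction.
module Submission where

open import Defs
open import Data.Bool as Bool using (Bool; true; false; if_then_else_)
open import Data.Empty using (⊥-elim)
open import Data.Fin using (Fin; zero; suc; toℕ; fromℕ<)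
open import Data.Fin.Permutation using (Permutation′; permutation; _⟨$⟩ʳ_; _⟨$⟩ˡ_; inverseˡ; inverseʳ)
open import Data.Fin.Properties using (_≟_; any?; toℕ-fromℕ<; toℕ-injective; toℕ<n)
import Data.Fin.Properties as Fin
open import Data.Fin.Subset
open import Data.Fin.Subset.Properties
open import Data.Fin.Subset.Induction using (⊂-wellFounded; ⊃-wellFounded; Acc; acc)
open import Data.Nat.ListAction using (sum)
open import Data.List using (List; []; _∷_; _++_; map; length; concatMap)
open import Data.List.Properties using (length-map; length-++)
open import Data.List.Membership.Propositional using (find; lose) renaming (_∈_ to _∈ˡ_; _∉_ to _∉ˡ_)
open import Data.List.Membership.Propositional.Properties
  using (∈-++⁺ˡ; ∈-++⁺ʳ; ∈-++⁻; ∈-map⁺; ∈-map⁻; ∈-concatMap⁺; ∈-concatMap⁻; ∈-∃++; ∈-allFin;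
    ∈-filter⁺; ∈-filter⁻; ∈-length)
open import Data.List.Relation.Unary.All as All using (All; []; _∷_)
open import Data.List.Relation.Unary.Any using (here; there)
open import Data.List.Relation.Unary.AllPairs using ([]; _∷_)
open import Data.List.Relation.Unary.Unique.Propositional using (Unique)
import Data.List.Relation.Unary.Unique.Propositional.Properties as Unique
open import Data.Nat using (ℕ; zero; suc; _+_; _*_; _≤_; _<_; s≤s; z≤n; _∸_; >-nonZero)
open import Data.Nat.Properties
  using (+-comm; suc-injective; m∸n+n≡m; *-suc; *-zeroʳ; *-distribˡ-+; *-monoˡ-<; m<m+n;
    +-monoˡ-≤; +-cancelʳ-≡; +-identityʳ; +-suc; <-trans; <-irrefl; <-asym; <-cmp; _<?_;
    m≤n⇒m<n∨m≡n; ≤-refl; m≤n⇒m≤1+n; 1+n≢n; <⇒≤; m≤m+n; m+[n∸m]≡n; 1+n≰n; ≤-trans; ≤-reflexive;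
    ≤-antisym; module ≤-Reasoning)
open import Data.Nat.Solver using (module +-*-Solver)
open +-*-Solver using (solve; _:=_; _:+_; _:*_; con)
open import Data.Product using (_×_; _,_; proj₁; proj₂; ∃; ∃₂)
open import Data.Sum as Sum using (_⊎_; inj₁; inj₂; [_,_]′; swap)
open import Data.Vec using ([]; _∷_; lookup; tabulate)
import Data.Vec.Properties as Vec
open import Function using (_∘_; id)
open import Function.Bundles using (_⇔_; mk⇔; Equivalence)
open import Relation.Binary.Definitions using (tri<; tri≈; tri>)
open import Relation.Binary.PropositionalEquality as ≡
  using (_≡_; _≢_; refl; trans; cong; cong₂; subst; subst₂)
open import Relation.Nullary using (¬_; Dec; yes; no; does; contradiction; ¬?)
open import Relation.Nullary.Decidable using (_×-dec_; _⊎-dec_; decidable-stable; dec-true)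
open import Relation.Unary using (Decidable)

private
  variable
    A B : Set
    n : ℕ

-- Comparing lengths of lists through relations

module _ (R : A → B → Set) where

  -- A relation takes the place of an injective map, because a pair `(U , v)` may be joined by
  -- several shortest paths and none of them is canonical.
  Total : List A → List B → Set
  Total xs ys = ∀ {x} → x ∈ˡ xs → ∃ λ y → y ∈ˡ ys × R x y

  Injective : List A → Set
  Injective xs = ∀ {x x′ y} → x ∈ˡ xs → x′ ∈ˡ xs → R x y → R x′ y → x ≡ x′

  private
    length-insert : (as : List B) {b : B} {bs : List B} →
      length (as ++ b ∷ bs) ≡ suc (length (as ++ bs))
    length-insert []       = refl
    length-insert (_ ∷ as) = cong suc (length-insert as)

    ∈-insert⁻ : ∀ as {b bs} {y : B} → y ∈ˡ as ++ b ∷ bs → y ≡ b ⊎ y ∈ˡ as ++ bs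
    ∈-insert⁻ as y∈ with ∈-++⁻ as y∈
    ... | inj₁ y∈as         = inj₂ (∈-++⁺ˡ y∈as)
    ... | inj₂ (here y≡b)   = inj₁ y≡b
    ... | inj₂ (there y∈bs) = inj₂ (∈-++⁺ʳ as y∈bs)

    remove : ∀ {x xs y} as {bs} → R x y → All (x ≢_) xs → Injective (x ∷ xs) →
      Total (x ∷ xs) (as ++ y ∷ bs) → Total xs (as ++ bs)
    remove as Rxy x∉xs inj tot x′∈ with tot (there x′∈)
    ... | y′ , y′∈ , Rx′y′ with ∈-insert⁻ as y′∈
    ...   | inj₁ refl = contradiction (inj (here refl) (there x′∈) Rxy Rx′y′) (All.lookup x∉xs x′∈)
    ...   | inj₂ y′∈′ = y′ , y′∈′ , Rx′y′

  -- Delete the partner of the first element: by injectivity no other element is related to it, so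
  -- the rest keeps its partners.
  injective⇒length≤ : ∀ {xs ys} → Unique xs → Total xs ys → Injective xs → length xs ≤ length ys
  injective⇒length≤ {[]} _ _ _ = z≤n
  injective⇒length≤ {x ∷ xs} (x∉xs ∷ u) tot inj with tot (here refl)
  ... | y , y∈ , Rxy with ∈-∃++ y∈
  ...   | as , bs , refl rewrite length-insert as {y} {bs} =
    s≤s (injective⇒length≤ u (remove as Rxy x∉xs inj tot) (λ p q → inj (there p) (there q)))

  -- The same deletion shortens both lists by one, so with equal lengths every `y` gets deleted at
  -- some point.
  injective⇒surjective : ∀ {xs ys} → Unique xs → Total xs ys → Injective xs →
    length xs ≡ length ys → ∀ {y} → y ∈ˡ ys → ∃ λ x → x ∈ˡ xs × R x y
  injective⇒surjective {[]} {_ ∷ _} _ _ _ ()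
  injective⇒surjective {x ∷ xs} (x∉xs ∷ u) tot inj eq y∈ with tot (here refl)
  ... | y₀ , y₀∈ , Rxy₀ with ∈-∃++ y₀∈
  ...   | as , bs , refl with ∈-insert⁻ as y∈
  ...     | inj₁ refl = x , here refl , Rxy₀
  ...     | inj₂ y∈′ with injective⇒surjective u (remove as Rxy₀ x∉xs inj tot)
                            (λ p q → inj (there p) (there q))
                            (suc-injective (trans eq (length-insert as))) y∈′
  ...       | x′ , x′∈ , Rx′y = x′ , there x′∈ , Rx′y

unique-concatMap : (f : A → List B) {xs : List A} → Unique xs → (∀ x → Unique (f x)) →
  (∀ {x x′ z} → z ∈ˡ f x → z ∈ˡ f x′ → x ≡ x′) → Unique (concatMap f xs)
unique-concatMap f []         uf inj = []
unique-concatMap f (x∉xs ∷ u) uf inj =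
  Unique.++⁺ (uf _) (unique-concatMap f u uf inj) λ (z∈ , z∈′) →
    let x′ , x′∈ , z∈fx′ = find (∈-concatMap⁻ f z∈′)
    in All.lookup x∉xs x′∈ (inj z∈ z∈fx′)

-- Enumerating subsets and their elements

elements : Subset n → List (Fin n)
elements []          = []
elements (true ∷ p)  = zero ∷ map suc (elements p)
elements (false ∷ p) = map suc (elements p)

length-elements : (p : Subset n) → length (elements p) ≡ ∣ p ∣
length-elements []          = refl
length-elements (true ∷ p)  = cong suc (trans (length-map suc (elements p)) (length-elements p))
length-elements (false ∷ p) = trans (length-map suc (elements p)) (length-elements p)

∈-elements⁺ : {p : Subset n} {x : Fin n} → x ∈ p → x ∈ˡ elements p
∈-elements⁺ {p = true ∷ p}  Data.Vec.here         = here refl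
∈-elements⁺ {p = true ∷ p}  (Data.Vec.there x∈p) = there (∈-map⁺ suc (∈-elements⁺ x∈p))
∈-elements⁺ {p = false ∷ p} (Data.Vec.there x∈p) = ∈-map⁺ suc (∈-elements⁺ x∈p)

∈-elements⁻ : (p : Subset n) {x : Fin n} → x ∈ˡ elements p → x ∈ p
∈-elements⁻ (true ∷ p) (here refl) = Data.Vec.here
∈-elements⁻ (true ∷ p) (there x∈) with ∈-map⁻ suc x∈
... | _ , y∈ , refl = Data.Vec.there (∈-elements⁻ p y∈)
∈-elements⁻ (false ∷ p) x∈ with ∈-map⁻ suc x∈
... | _ , y∈ , refl = Data.Vec.there (∈-elements⁻ p y∈)

unique-elements : (p : Subset n) → Unique (elements p)
unique-elements []          = []
unique-elements (true ∷ p)  =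
  All.tabulate (λ y∈ eq → case-zero (subst (_∈ˡ map suc (elements p)) (≡.sym eq) y∈))
  ∷ Unique.map⁺ Fin.suc-injective (unique-elements p)
  where
    case-zero : zero ∉ˡ map suc (elements p)
    case-zero z∈ with ∈-map⁻ suc z∈
    ... | _ , _ , ()
unique-elements (false ∷ p) = Unique.map⁺ Fin.suc-injective (unique-elements p)

∈-allSubsets : (p : Subset n) → p ∈ˡ allSubsets n
∈-allSubsets []          = here refl
∈-allSubsets (true ∷ p)  = ∈-++⁺ˡ (∈-map⁺ _ (∈-allSubsets p))
∈-allSubsets (false ∷ p) = ∈-++⁺ʳ _ (∈-map⁺ _ (∈-allSubsets p))

unique-allSubsets : ∀ n → Unique (allSubsets n)
unique-allSubsets zero    = [] ∷ []
unique-allSubsets (suc n) =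
  Unique.++⁺ (Unique.map⁺ Vec.∷-injectiveʳ (unique-allSubsets n))
             (Unique.map⁺ Vec.∷-injectiveʳ (unique-allSubsets n))
             λ (p∈ , p∈′) → disjoint p∈ p∈′
  where
    disjoint : ∀ {p} → p ∈ˡ map (true ∷_) (allSubsets n) → p ∉ˡ map (false ∷_) (allSubsets n)
    disjoint p∈ p∈′ with ∈-map⁻ (true ∷_) p∈ | ∈-map⁻ (false ∷_) p∈′
    ... | _ , _ , refl | _ , _ , ()

module _ {P : Fin n → Set} (P? : Decidable P) where

  setOf : Subset n
  setOf = tabulate (does ∘ P?)

  ∈-setOf⁺ : ∀ {x} → P x → x ∈ setOf
  ∈-setOf⁺ {x} Px =
    Vec.lookup⇒[]= x setOf (trans (Vec.lookup∘tabulate (does ∘ P?) x) (dec-true (P? x) Px))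

  ∈-setOf⁻ : ∀ {x} → x ∈ setOf → P x
  ∈-setOf⁻ {x} x∈ with P? x | trans (≡.sym (Vec.lookup∘tabulate (does ∘ P?) x)) (Vec.[]=⇒lookup x∈)
  ... | yes Px | _ = Px
  ... | no _   | ()

∖? : ∀ (p : Subset n) w → Decidable (λ z → z ∈ p × z ≢ w)
∖? p w z = z ∈? p ×-dec ¬? (z ≟ w)

infixl 6 _∖_

_∖_ : Subset n → Fin n → Subset n
p ∖ w = setOf (∖? p w)

∈-∖⁺ : ∀ {p : Subset n} {w z} → z ∈ p → z ≢ w → z ∈ p ∖ w
∈-∖⁺ {p = p} {w} z∈p z≢w = ∈-setOf⁺ (∖? p w) (z∈p , z≢w)

∈-∖⁻ : ∀ {p : Subset n} {w z} → z ∈ p ∖ w → z ∈ p × z ≢ w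
∈-∖⁻ {p = p} {w} = ∈-setOf⁻ (∖? p w)

infixl 6 _⊹_

_⊹_ : Subset n → Fin n → Subset n
p ⊹ w = p ∪ ⁅ w ⁆

∈-⊹⁻ : ∀ {p : Subset n} {w z} → z ∈ p ⊹ w → z ∈ p ⊎ z ≡ w
∈-⊹⁻ {p = p} {w} z∈ with x∈p∪q⁻ p ⁅ w ⁆ z∈
... | inj₁ z∈p = inj₁ z∈p
... | inj₂ z∈w = inj₂ (x∈⁅y⁆⇒x≡y w z∈w)

⊆-⊹ : ∀ {p : Subset n} {w z} → z ∈ p → z ∈ p ⊹ w
⊆-⊹ {w = w} = p⊆p∪q ⁅ w ⁆

∈-⊹ : ∀ {p : Subset n} {w} → w ∈ p ⊹ w
∈-⊹ {p = p} {w} = q⊆p∪q p ⁅ w ⁆ (x∈⁅x⁆ w)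

-- Walks, connected sets and non-cut vertices

module _ {G : Graph n} where

  Adjacent-sym : ∀ {u v} → Adjacent G u v → Adjacent G v u
  Adjacent-sym {u} {v} uv = trans (Graph.sym G v u) uv

  Adjacent-irrefl : ∀ {u} → ¬ Adjacent G u u
  Adjacent-irrefl {u} uu with trans (≡.sym uu) (irrefl G u)
  ... | ()

  adjacent? : ∀ u v → Dec (Adjacent G u v)
  adjacent? u v = adj G u v Bool.≟ true

  walk-start : ∀ {U x y} → WalkIn G U x y → x ∈ U
  walk-start (here x∈)     = x∈
  walk-start (step x∈ _ _) = x∈

  walk-end : ∀ {U x y} → WalkIn G U x y → y ∈ U
  walk-end (here x∈)    = x∈
  walk-end (step _ _ p) = walk-end p

  walk-mono : ∀ {U V x y} → U ⊆ V → WalkIn G U x y → WalkIn G V x y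
  walk-mono U⊆V (here x∈)      = here (U⊆V x∈)
  walk-mono U⊆V (step x∈ xw p) = step (U⊆V x∈) xw (walk-mono U⊆V p)

  walk-snoc : ∀ {U x y z} → WalkIn G U x y → Adjacent G y z → z ∈ U → WalkIn G U x z
  walk-snoc (here x∈)      yz z∈ = step x∈ yz (here z∈)
  walk-snoc (step x∈ xw p) yz z∈ = step x∈ xw (walk-snoc p yz z∈)

  walk-reverse : ∀ {U x y} → WalkIn G U x y → WalkIn G U y x
  walk-reverse (here x∈)      = here x∈
  walk-reverse (step x∈ xw p) = walk-snoc (walk-reverse p) (Adjacent-sym xw) x∈

  walk-closed : ∀ {U x y} (T : Fin n → Set) →
    (∀ {a b} → a ∈ U → b ∈ U → Adjacent G a b → T a → T b) →
    WalkIn G U x y → T x → T y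
  walk-closed T closed (here _)       Tx = Tx
  walk-closed T closed (step x∈ xw p) Tx =
    walk-closed T closed p (closed x∈ (walk-start p) xw Tx)

  walk-closed⁻ : ∀ {U x y} (T : Fin n → Set) →
    (∀ {a b} → a ∈ U → b ∈ U → Adjacent G a b → T a → T b) →
    WalkIn G U x y → T y → T x
  walk-closed⁻ T closed (here _)       Ty = Ty
  walk-closed⁻ T closed (step x∈ xw p) Ty =
    closed (walk-start p) x∈ (Adjacent-sym xw) (walk-closed⁻ T closed p Ty)

  crossing : ∀ {H x y} (K : Subset n) → WalkIn G H x y → x ∈ K → y ∉ K →
    ∃₂ λ a b → a ∈ K × b ∈ H × b ∉ K × Adjacent G a b
  crossing K (here _) x∈K x∉K = contradiction x∈K x∉K
  crossing K (step {w = w} _ xw p) x∈K y∉K with w ∈? K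
  ... | yes w∈K = crossing K p w∈K y∉K
  ... | no w∉K  = _ , w , x∈K , walk-start p , w∉K , xw

  connected-⊹ : ∀ {K a b} → ConnectedSet G K → a ∈ K → Adjacent G a b → ConnectedSet G (K ⊹ b)
  connected-⊹ {K} {a} {b} (_ , conn) a∈K ab = (a , ⊆-⊹ a∈K) , λ u v u∈ v∈ → go (∈-⊹⁻ u∈) (∈-⊹⁻ v∈)
    where
      inside-K : ∀ {u v} → u ∈ K → v ∈ K → WalkIn G (K ⊹ b) u v
      inside-K u∈ v∈ = walk-mono ⊆-⊹ (conn _ _ u∈ v∈)

      go : ∀ {u v} → u ∈ K ⊎ u ≡ b → v ∈ K ⊎ v ≡ b → WalkIn G (K ⊹ b) u v
      go (inj₁ u∈)   (inj₁ v∈)   = inside-K u∈ v∈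
      go (inj₁ u∈)   (inj₂ refl) = walk-snoc (inside-K u∈ a∈K) ab ∈-⊹
      go (inj₂ refl) (inj₁ v∈)   = step ∈-⊹ (Adjacent-sym ab) (inside-K a∈K v∈)
      go (inj₂ refl) (inj₂ refl) = here ∈-⊹

  singleton-connected : ∀ x → ConnectedSet G ⁅ x ⁆
  singleton-connected x = (x , x∈⁅x⁆ x) , λ u v u∈ v∈ → go (x∈⁅y⁆⇒x≡y x u∈) (x∈⁅y⁆⇒x≡y x v∈)
    where
      go : ∀ {u v} → u ≡ x → v ≡ x → WalkIn G ⁅ x ⁆ u v
      go refl refl = here (x∈⁅x⁆ x)

  -- Grow `K` inside `H` along edges, one vertex at a time. It stays connected, and just before the
  -- last vertex `b` of `H` is added it equals `H ∖ b`.
  nonCut-outside : ∀ {H K z} → ConnectedSet G H → ConnectedSet G K → K ⊆ H → z ∈ H → z ∉ K →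
    ∃ λ x → x ∈ H × x ∉ K × ConnectedSet G (H ∖ x)
  nonCut-outside {H} {K} {z} (ne , connH) = go K (⊃-wellFounded K)
    where
      go : ∀ {z} K → Acc _⊃_ K → ConnectedSet G K → K ⊆ H → z ∈ H → z ∉ K →
        ∃ λ x → x ∈ H × x ∉ K × ConnectedSet G (H ∖ x)
      go {z} K (acc rec) K-conn@((k , k∈K) , _) K⊆H z∈H z∉K
        with crossing K (connH k z (K⊆H k∈K) z∈H) k∈K z∉K
      ... | a , b , a∈K , b∈H , b∉K , ab
        with any? (λ y → y ∈? H ×-dec ¬? (y ∈? (K ⊹ b)))
      ...   | yes (y , y∈H , y∉K⊹b) =
        let x , x∈H , x∉K⊹b , conn =
              go (K ⊹ b) (rec (⊆-⊹ , b , ∈-⊹ , b∉K)) (connected-⊹ K-conn a∈K ab)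
                 (λ y∈ → [ K⊆H , (λ { refl → b∈H }) ]′ (∈-⊹⁻ y∈)) y∈H y∉K⊹b
        in x , x∈H , x∉K⊹b ∘ ⊆-⊹ , conn
      ...   | no all-in = b , b∈H , b∉K , subst (ConnectedSet G) K≡H∖b K-conn
        where
          H∖b⊆K : H ∖ b ⊆ K
          H∖b⊆K {y} y∈ with ∈-∖⁻ y∈
          ... | y∈H , y≢b with y ∈? (K ⊹ b)
          ...   | no y∉ = contradiction (y , y∈H , y∉) all-in
          ...   | yes y∈⊹ with ∈-⊹⁻ y∈⊹
          ...     | inj₁ y∈K = y∈K
          ...     | inj₂ y≡b = contradiction y≡b y≢b

          K≡H∖b : K ≡ H ∖ b
          K≡H∖b = ⊆-antisym (λ y∈K → ∈-∖⁺ (K⊆H y∈K) (λ { refl → b∉K y∈K })) H∖b⊆K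

  -- Growing from `x` yields a non-cut vertex `a` other than `x`; growing from `a` yields a second
  -- one.
  two-nonCut : ∀ {H x y} → ConnectedSet G H → x ∈ H → y ∈ H → x ≢ y →
    ∃₂ λ a b → a ∈ H × b ∈ H × a ≢ b × ConnectedSet G (H ∖ a) × ConnectedSet G (H ∖ b)
  two-nonCut {H} {x} {y} H-conn x∈H y∈H x≢y =
    let a , a∈H , a∉x , conn-a = nonCut-≢ x x∈H y∈H (x≢y ∘ ≡.sym)
        b , b∈H , b∉a , conn-b = nonCut-≢ a a∈H x∈H (a∉x ∘ ≡.sym)
    in a , b , a∈H , b∈H , b∉a ∘ ≡.sym , conn-a , conn-b
    where
      nonCut-≢ : ∀ x {y} → x ∈ H → y ∈ H → y ≢ x →
        ∃ λ z → z ∈ H × z ≢ x × ConnectedSet G (H ∖ z)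
      nonCut-≢ x x∈H y∈H y≢x =
        let z , z∈H , z∉ , conn = nonCut-outside H-conn (singleton-connected x)
              (λ u∈ → subst (_∈ H) (≡.sym (x∈⁅y⁆⇒x≡y x u∈)) x∈H) y∈H (x≢y⇒x∉⁅y⁆ y≢x)
        in z , z∈H , (λ z≡x → z∉ (subst (_∈ ⁅ x ⁆) (≡.sym z≡x) (x∈⁅x⁆ x))) , conn

  -- Legs: a set with an induced path attached

  -- H is U together with an induced path w … v of which only w has neighbours in U.
  data Leg (U : Subset n) : Subset n → Fin n → Fin n → Set where
    base   : ∀ {u w} → u ∈ U → w ∉ U → Adjacent G u w → Leg U (U ⊹ w) w w
    extend : ∀ {H w q r} → Leg U H w q → r ∉ H → Adjacent G q r →
      (∀ {x} → x ∈ H → Adjacent G x r → x ≡ q) → Leg U (H ⊹ r) w r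

  module _ {U : Subset n} where

    leg-⊆ : ∀ {H w v} → Leg U H w v → U ⊆ H
    leg-⊆ (base _ _ _)       = ⊆-⊹
    leg-⊆ (extend leg _ _ _) = ⊆-⊹ ∘ leg-⊆ leg

    leg-nonempty : ∀ {H w v} → Leg U H w v → Nonempty U
    leg-nonempty (base u∈ _ _)      = _ , u∈
    leg-nonempty (extend leg _ _ _) = leg-nonempty leg

    leg-attach∉ : ∀ {H w v} → Leg U H w v → w ∉ U
    leg-attach∉ (base _ w∉ _)      = w∉
    leg-attach∉ (extend leg _ _ _) = leg-attach∉ leg

    leg-attach∈ : ∀ {H w v} → Leg U H w v → w ∈ H
    leg-attach∈ (base _ _ _)       = ∈-⊹
    leg-attach∈ (extend leg _ _ _) = ⊆-⊹ (leg-attach∈ leg)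

    leg-tip∈ : ∀ {H w v} → Leg U H w v → v ∈ H
    leg-tip∈ (base _ _ _)     = ∈-⊹
    leg-tip∈ (extend _ _ _ _) = ∈-⊹

    leg-tip∉ : ∀ {H w v} → Leg U H w v → v ∉ U
    leg-tip∉ (base _ w∉ _)       = w∉
    leg-tip∉ (extend leg r∉ _ _) = r∉ ∘ leg-⊆ leg

    leg-connected : ∀ {H w v} → ConnectedSet G U → Leg U H w v → ConnectedSet G H
    leg-connected conn (base u∈ _ uw)       = connected-⊹ conn u∈ uw
    leg-connected conn (extend leg _ qr _) = connected-⊹ (leg-connected conn leg) (leg-tip∈ leg) qr

    leg-trivial : ∀ {H w z} → Leg U H w w → z ∈ H → z ∉ U → z ≡ w
    leg-trivial (base _ _ _)        z∈ z∉ = [ (λ z∈U → contradiction z∈U z∉) , id ]′ (∈-⊹⁻ z∈)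
    leg-trivial (extend leg r∉ _ _) z∈ z∉ = contradiction (leg-attach∈ leg) r∉

    -- A later path vertex adjacent to `x` in `U` would make `x` the previous tip, which lies
    -- outside `U`. Hence inside `H` the set `U` can be left only through `w`.
    leg-closed : ∀ {H w v x y} → Leg U H w v → x ∈ U → y ∈ H → y ∉ U → Adjacent G x y → y ≡ w
    leg-closed (base _ _ _) _ y∈ y∉ _ = [ (λ y∈U → contradiction y∈U y∉) , id ]′ (∈-⊹⁻ y∈)
    leg-closed (extend leg _ _ uniq) x∈ y∈ y∉ xy with ∈-⊹⁻ y∈
    ... | inj₁ y∈H  = leg-closed leg x∈ y∈H y∉ xy
    ... | inj₂ refl with uniq (leg-⊆ leg x∈) xy
    ...   | refl = contradiction x∈ (leg-tip∉ leg)

    -- The walk follows the path towards its tip, so the part of `H ∖ w` outside `U` is connected.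
    -- `K` is a separate parameter because it stays fixed while the induction shrinks `H`.
    leg-walk : ∀ {H w v K z} → Leg U H w v → (∀ {x} → x ∈ H → x ∉ U → x ≢ w → x ∈ K) →
      z ∈ H → z ∉ U → z ≢ w → WalkIn G K z v
    leg-walk leg@(base _ _ _) _ z∈ z∉ z≢w = contradiction (leg-trivial leg z∈ z∉) z≢w
    leg-walk {w = w} (extend {q = q} leg r∉ qr _) K⊇ z∈ z∉ z≢w with ∈-⊹⁻ z∈
    ... | inj₂ refl = here (K⊇ z∈ z∉ z≢w)
    ... | inj₁ z∈H with q ≟ w
    ...   | yes refl = contradiction (leg-trivial leg z∈H z∉) z≢w
    ...   | no q≢w   = walk-snoc (leg-walk leg (K⊇ ∘ ⊆-⊹) z∈H z∉ z≢w) qr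
      (K⊇ ∈-⊹ (r∉ ∘ leg-⊆ leg) (λ { refl → r∉ (leg-attach∈ leg) }))

    leg-tip-degree≥1 : ∀ {H w v} → Leg U H w v → ∃ λ a → a ∈ H × Adjacent G a v
    leg-tip-degree≥1 (base u∈ _ uw)      = _ , ⊆-⊹ u∈ , uw
    leg-tip-degree≥1 (extend leg _ qr _) = _ , ⊆-⊹ (leg-tip∈ leg) , qr

    leg-tip-degree≤1 : ∀ {H w v a b} → Leg U H w v → v ≢ w → a ∈ H → b ∈ H →
      Adjacent G a v → Adjacent G b v → a ≡ b
    leg-tip-degree≤1 (base _ _ _) v≢w = contradiction refl v≢w
    leg-tip-degree≤1 {a = a} {b} (extend leg _ _ uniq) _ a∈ b∈ av bv =
      trans (≡tip (∈-⊹⁻ a∈) av) (≡.sym (≡tip (∈-⊹⁻ b∈) bv))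
      where
        ≡tip : ∀ {x} → _ → Adjacent G x _ → x ≡ _
        ≡tip (inj₁ x∈)   xv = uniq x∈ xv
        ≡tip (inj₂ refl) vv = contradiction vv Adjacent-irrefl

    leg-inner-degree≥2 : ∀ {H w v z} → Leg U H w v → z ∈ H → z ∉ U → z ≢ v →
      ∃₂ λ a b → a ∈ H × b ∈ H × a ≢ b × Adjacent G a z × Adjacent G b z
    leg-inner-degree≥2 leg@(base _ _ _) z∈ z∉ z≢v = contradiction (leg-trivial leg z∈ z∉) z≢v
    leg-inner-degree≥2 {z = z} (extend {q = q} leg r∉ qr _) z∈ z∉ z≢r with ∈-⊹⁻ z∈
    ... | inj₂ z≡r = contradiction z≡r z≢r
    ... | inj₁ z∈H with z ≟ q
    ...   | yes refl =
      let a , a∈ , aq = leg-tip-degree≥1 leg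
      in a , _ , ⊆-⊹ a∈ , ∈-⊹ , (λ { refl → r∉ a∈ }) , aq , Adjacent-sym qr
    ...   | no z≢q =
      let a , b , a∈ , b∈ , a≢b , az , bz = leg-inner-degree≥2 leg z∈H z∉ z≢q
      in a , b , ⊆-⊹ a∈ , ⊆-⊹ b∈ , a≢b , az , bz

    -- Apart from `w`, a tip has at most one neighbour in `H`, whereas every other path vertex has
    -- at least two. The vertex `w` is treated first, since it may have many neighbours in `U`; if
    -- it is a tip, it is the whole path.
    leg-tip-unique : ∀ {H w v v′} → Leg U H w v → Leg U H w v′ → v ≡ v′
    leg-tip-unique {w = w} {v} {v′} leg leg′ with v′ ≟ w
    ... | yes refl = leg-trivial leg′ (leg-tip∈ leg) (leg-tip∉ leg)
    ... | no v′≢w with v′ ≟ v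
    ...   | yes v′≡v = ≡.sym v′≡v
    ...   | no v′≢v  =
      let a , b , a∈ , b∈ , a≢b , av′ , bv′ = leg-inner-degree≥2 leg (leg-tip∈ leg′) (leg-tip∉ leg′) v′≢v
      in contradiction (leg-tip-degree≤1 leg′ v′≢w a∈ b∈ av′ bv′) a≢b

  -- Degrees on a leg, and the components of `H ∖ w`

  AtMostTwo : (Fin n → Set) → Set
  AtMostTwo P = ∀ {a b c} → P a → P b → P c → a ≡ b ⊎ b ≡ c ⊎ a ≡ c

  module _ {U : Subset n} where

    -- The path starts at `w`, so its only path neighbour is the next vertex. In the equality case
    -- two legs at the same `w` together bound its degree.
    leg-attach-degree : ∀ {H w v a b} → Leg U H w v → a ∈ H → b ∈ H → a ∉ U → b ∉ U →
      Adjacent G a w → Adjacent G b w → a ≡ b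
    leg-attach-degree leg@(base _ _ _) a∈ b∈ a∉ b∉ aw bw with leg-trivial leg a∈ a∉
    ... | refl = contradiction aw Adjacent-irrefl
    leg-attach-degree {w = w} (extend {q = q} {r} leg r∉ qr uniq) a∈ b∈ a∉ b∉ aw bw with q ≟ w
    ... | yes refl = trans (≡r (∈-⊹⁻ a∈) a∉ aw) (≡.sym (≡r (∈-⊹⁻ b∈) b∉ bw))
      where
        ≡r : ∀ {x} → _ → x ∉ U → Adjacent G x w → x ≡ r
        ≡r (inj₂ x≡r) _ _ = x≡r
        ≡r (inj₁ x∈) x∉ xw with leg-trivial leg x∈ x∉
        ... | refl = contradiction xw Adjacent-irrefl
    ... | no q≢w = leg-attach-degree leg (old (∈-⊹⁻ a∈) aw) (old (∈-⊹⁻ b∈) bw) a∉ b∉ aw bw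
      where
        old : ∀ {x} → x ∈ _ ⊎ x ≡ r → Adjacent G x w → x ∈ _
        old (inj₁ x∈)   _  = x∈
        old (inj₂ refl) rw = contradiction (≡.sym (uniq (leg-attach∈ leg) (Adjacent-sym rw))) q≢w

    -- Adding `r` affects only the degrees of `r` and `q`; and `q`, when it is not `w`, was a tip
    -- with at most one neighbour before.
    leg-degree≤2 : ∀ {H w v z} → Leg U H w v → z ∈ H → z ∉ U → z ≢ w →
      AtMostTwo (λ a → a ∈ H × Adjacent G a z)
    leg-degree≤2 leg@(base _ _ _) z∈ z∉ z≢w = contradiction (leg-trivial leg z∈ z∉) z≢w
    leg-degree≤2 {w = w} {z = z} full@(extend {H = H} {q = q} {r = r} leg r∉ qr uniq) z∈ z∉ z≢w
      {a} {b} {c} (a∈ , az) (b∈ , bz) (c∈ , cz) with ∈-⊹⁻ z∈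
    ... | inj₂ refl = inj₁ (leg-tip-degree≤1 full z≢w a∈ b∈ az bz)
    ... | inj₁ z∈H with z ≟ q
    ...   | no z≢q = leg-degree≤2 leg z∈H z∉ z≢w
                       (old (∈-⊹⁻ a∈) az , az) (old (∈-⊹⁻ b∈) bz , bz) (old (∈-⊹⁻ c∈) cz , cz)
      where
        old : ∀ {x} → x ∈ H ⊎ x ≡ r → Adjacent G x z → x ∈ H
        old (inj₁ x∈)   _  = x∈
        old (inj₂ refl) rz = contradiction (uniq z∈H (Adjacent-sym rz)) z≢q
    ...   | yes refl with ∈-⊹⁻ a∈ | ∈-⊹⁻ b∈ | ∈-⊹⁻ c∈
    ...     | inj₁ a∈′ | inj₁ b∈′ | _        = inj₁ (leg-tip-degree≤1 leg z≢w a∈′ b∈′ az bz)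
    ...     | inj₁ a∈′ | inj₂ _   | inj₁ c∈′ = inj₂ (inj₂ (leg-tip-degree≤1 leg z≢w a∈′ c∈′ az cz))
    ...     | inj₂ _   | inj₁ b∈′ | inj₁ c∈′ = inj₂ (inj₁ (leg-tip-degree≤1 leg z≢w b∈′ c∈′ bz cz))
    ...     | inj₂ e   | inj₂ e′  | _        = inj₁ (trans e (≡.sym e′))
    ...     | inj₂ e   | inj₁ _   | inj₂ e′  = inj₂ (inj₂ (trans e (≡.sym e′)))
    ...     | inj₁ _   | inj₂ e   | inj₂ e′  = inj₂ (inj₁ (trans e (≡.sym e′)))

  -- By `leg-closed`, a connected set that meets `U` and stays in `H ∖ w` cannot leave `U`. So a
  -- connected `U` is a component of `H ∖ w`.
  leg-⊆-component : ∀ {U H w v V x} → Leg U H w v → V ⊆ H → w ∉ V → InducedConnected G V →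
    x ∈ U → x ∈ V → V ⊆ U
  leg-⊆-component {U} {x = x} leg V⊆H w∉V conn x∈U x∈V {y} y∈V =
    walk-closed (_∈ U) closed (conn x y x∈V y∈V) x∈U
    where
      closed : ∀ {a b} → a ∈ _ → b ∈ _ → Adjacent G a b → a ∈ U → b ∈ U
      closed {b = b} _ b∈V ab a∈U with b ∈? U
      ... | yes b∈U = b∈U
      ... | no b∉U with leg-closed leg a∈U (V⊆H b∈V) b∉U ab
      ...   | refl = contradiction b∈V w∉V

  leg-common⇒≡ : ∀ {U U′ H w v v′ x} → ConnectedSet G U → ConnectedSet G U′ →
    Leg U H w v → Leg U′ H w v′ → x ∈ U → x ∈ U′ → U ≡ U′
  leg-common⇒≡ (_ , conn) (_ , conn′) leg leg′ x∈ x∈′ = ⊆-antisym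
    (leg-⊆-component leg′ (leg-⊆ leg) (leg-attach∉ leg) conn x∈′ x∈)
    (leg-⊆-component leg (leg-⊆ leg′) (leg-attach∉ leg′) conn′ x∈ x∈′)

  -- The part of `H ∖ w` outside `U` is connected and contains `m`. Since `U′` avoids `m` and can be
  -- left only through `w`, it avoids this whole part.
  leg-avoid⇒⊆ : ∀ {U U′ H w v v′ m} → Leg U H w v → Leg U′ H w v′ → m ∈ H → m ≢ w →
    m ∉ U → m ∉ U′ → U′ ⊆ U
  leg-avoid⇒⊆ {U} {U′} {H} {w} {v} {m = m} leg leg′ m∈H m≢w m∉U m∉U′ {z} z∈U′ with z ∈? U
  ... | yes z∈U = z∈U
  -- Avoidance of `U′` is carried from `m` to the tip `v`, then back from `v` to `z`.
  ... | no z∉U  = contradiction z∈U′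
    (walk-closed⁻ (_∉ U′) closed (walk z∈H z∉U z≢w) (walk-closed (_∉ U′) closed (walk m∈H m∉U m≢w) m∉U′))
    where
      z∈H : z ∈ H
      z∈H = leg-⊆ leg′ z∈U′

      z≢w : z ≢ w
      z≢w refl = leg-attach∉ leg′ z∈U′

      walk : ∀ {x} → x ∈ H → x ∉ U → x ≢ w → WalkIn G (H ∖ w) x v
      walk = leg-walk leg (λ x∈ _ x≢w → ∈-∖⁺ x∈ x≢w)

      closed : ∀ {a b} → a ∈ H ∖ w → b ∈ H ∖ w → Adjacent G a b → a ∉ U′ → b ∉ U′
      closed a∈ b∈ ab a∉ b∈U′ =
        let a∈H , a≢w = ∈-∖⁻ a∈
        in a≢w (leg-closed leg′ b∈U′ a∈H a∉ (Adjacent-sym ab))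

  -- Shortest paths from distance layers

  -- Layer k consists of the vertices at distance at most k from U.
  Layer : Subset n → ℕ → Fin n → Set
  Layer U zero    v = v ∈ U
  Layer U (suc k) v = Layer U k v ⊎ ∃ λ u → Layer U k u × Adjacent G u v

  layer? : ∀ U k v → Dec (Layer U k v)
  layer? U zero    v = v ∈? U
  layer? U (suc k) v = layer? U k v ⊎-dec any? (λ u → layer? U k u ×-dec adjacent? u v)

  walk⇒layer : ∀ {U V u v k} → WalkIn G V u v → Layer U k u → ∃ λ l → Layer U l v
  walk⇒layer (here _)      Lu = _ , Lu
  walk⇒layer (step _ uw p) Lu = walk⇒layer p (inj₂ (_ , Lu , uw))

  layer-first : ∀ {U v} k → Layer U k v → v ∉ U → ∃ λ l → Layer U (suc l) v × ¬ Layer U l v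
  layer-first zero    v∈U v∉U = contradiction v∈U v∉U
  layer-first {U} {v} (suc k) Lv v∉U with layer? U k v
  ... | yes Lkv = layer-first k Lkv v∉U
  ... | no ¬Lkv = k , Lv , ¬Lkv

  -- The last conjunct drives the induction: all of `H` but its tip `u` lies one layer lower, so a
  -- vertex `v` that first appears in the layer after that of `u` has no neighbour in `H` except
  -- `u`.
  layer⇒leg : ∀ {U} k {v} → Layer U (suc k) v → ¬ Layer U k v →
    ∃₂ λ H w → Leg U H w v × (∀ {z} → z ∈ H → z ≡ v ⊎ Layer U k z)
  layer⇒leg k (inj₁ Lv) ¬Lv = contradiction Lv ¬Lv
  layer⇒leg zero (inj₂ (u , u∈U , uv)) v∉U = _ , _ , base u∈U v∉U uv , swap ∘ ∈-⊹⁻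
  layer⇒leg {U} (suc k) {v} (inj₂ (u , Lu , uv)) ¬Lv
    with layer⇒leg k Lu (λ Lku → ¬Lv (inj₂ (u , Lku , uv)))
  ... | H , w , leg , near = _ , w , extend leg v∉H uv uniq , swap ∘ Sum.map₁ H-layer ∘ ∈-⊹⁻
    where
      H-layer : ∀ {z} → z ∈ H → Layer U (suc k) z
      H-layer z∈ = [ (λ { refl → Lu }) , inj₁ ]′ (near z∈)

      v∉H : v ∉ H
      v∉H = ¬Lv ∘ H-layer

      uniq : ∀ {x} → x ∈ H → Adjacent G x v → x ≡ u
      uniq x∈ xv = [ id , (λ Lx → contradiction (inj₂ (_ , Lx , xv)) ¬Lv) ]′ (near x∈)

  leg-exists : ∀ {U v} → Connected G → ConnectedSet G U → v ∉ U → ∃₂ λ H w → Leg U H w v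
  leg-exists {U} {v} (_ , conn) ((u , u∈U) , _) v∉U =
    let k , Lk        = walk⇒layer {U} {k = 0} (conn u v ∈⊤ ∈⊤) u∈U
        l , Ll , ¬Ll  = layer-first k Lk v∉U
        H , w , leg , _ = layer⇒leg l Ll ¬Ll
    in H , w , leg

-- Counting items and slots

module _ {n} (G : Graph n) (dec : ∀ U → Dec (ConnectedSet G U)) where

  -- The left-hand side of the count: pairs of a connected set and a vertex outside it, and two
  -- further markers for each connected set.
  Item : Set
  Item = (Subset n × Fin n) ⊎ (Subset n × Bool)

  -- The bit is meant to name one of two components of `H ∖ w`. Each connected `H` thus offers
  -- `2 * ∣ H ∣` slots.
  Slot : Set
  Slot = Subset n × Fin n × Bool

  ValidItem : Item → Set
  ValidItem (inj₁ (U , v)) = ConnectedSet G U × v ∉ U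
  ValidItem (inj₂ (H , _)) = ConnectedSet G H

  ValidSlot : Slot → Set
  ValidSlot (H , w , _) = ConnectedSet G H × w ∈ H

  itemsOf : Subset n → List Item
  itemsOf U = inj₂ (U , true) ∷ inj₂ (U , false) ∷ map (λ v → inj₁ (U , v)) (elements (∁ U))

  slotsAt : Subset n → Fin n → List Slot
  slotsAt H w = (H , w , true) ∷ (H , w , false) ∷ []

  slotsOf : Subset n → List Slot
  slotsOf H = concatMap (slotsAt H) (elements H)

  items : List Item
  items = concatMap itemsOf (connectedSets G dec)

  slots : List Slot
  slots = concatMap slotsOf (connectedSets G dec)

  private
    ∈-connectedSets⁺ : ∀ {U} → ConnectedSet G U → U ∈ˡ connectedSets G dec
    ∈-connectedSets⁺ = ∈-filter⁺ dec (∈-allSubsets _)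

    ∈-connectedSets⁻ : ∀ {U} → U ∈ˡ connectedSets G dec → ConnectedSet G U
    ∈-connectedSets⁻ U∈ = proj₂ (∈-filter⁻ dec {xs = allSubsets n} U∈)

    unique-connectedSets : Unique (connectedSets G dec)
    unique-connectedSets = Unique.filter⁺ dec (unique-allSubsets n)

    itemSet : Item → Subset n
    itemSet (inj₁ (U , _)) = U
    itemSet (inj₂ (U , _)) = U

    ∈-itemsOf⁻ : ∀ {U x} → x ∈ˡ itemsOf U → U ≡ itemSet x × (ConnectedSet G U → ValidItem x)
    ∈-itemsOf⁻ (here refl)         = refl , id
    ∈-itemsOf⁻ (there (here refl)) = refl , id
    ∈-itemsOf⁻ {U} (there (there x∈)) with ∈-map⁻ _ x∈
    ... | v , v∈ , refl = refl , λ conn → conn , x∈∁p⇒x∉p (∈-elements⁻ (∁ U) v∈)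

    ∈-slotsOf⁻ : ∀ {H H′ w b} → (H′ , w , b) ∈ˡ slotsOf H → H ≡ H′ × w ∈ H
    ∈-slotsOf⁻ {H} y∈ with find (∈-concatMap⁻ (slotsAt H) {xs = elements H} y∈)
    ... | w , w∈ , here refl         = refl , ∈-elements⁻ H w∈
    ... | w , w∈ , there (here refl) = refl , ∈-elements⁻ H w∈

  ∈-items⁺ : ∀ {x} → ValidItem x → x ∈ˡ items
  ∈-items⁺ {inj₁ (U , v)} (conn , v∉U) = ∈-concatMap⁺ itemsOf (lose (∈-connectedSets⁺ conn)
    (there (there (∈-map⁺ _ (∈-elements⁺ (x∉p⇒x∈∁p v∉U))))))
  ∈-items⁺ {inj₂ (H , true)} conn =
    ∈-concatMap⁺ itemsOf (lose (∈-connectedSets⁺ conn) (here refl))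
  ∈-items⁺ {inj₂ (H , false)} conn =
    ∈-concatMap⁺ itemsOf (lose (∈-connectedSets⁺ conn) (there (here refl)))

  ∈-items⁻ : ∀ {x} → x ∈ˡ items → ValidItem x
  ∈-items⁻ x∈ with find (∈-concatMap⁻ itemsOf {xs = connectedSets G dec} x∈)
  ... | U , U∈ , x∈U = proj₂ (∈-itemsOf⁻ x∈U) (∈-connectedSets⁻ U∈)

  unique-items : Unique items
  unique-items = unique-concatMap itemsOf unique-connectedSets unique-itemsOf
    λ z∈ z∈′ → trans (proj₁ (∈-itemsOf⁻ z∈)) (≡.sym (proj₁ (∈-itemsOf⁻ z∈′)))
    where
      unique-itemsOf : ∀ U → Unique (itemsOf U)
      unique-itemsOf U =
        ((λ ()) ∷ All.tabulate (λ x∈ → marker≢ x∈))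
        ∷ All.tabulate (λ x∈ → marker≢ x∈)
        ∷ Unique.map⁺ (λ { refl → refl }) (unique-elements (∁ U))
        where
          marker≢ : ∀ {b x} → x ∈ˡ map (λ v → inj₁ (U , v)) (elements (∁ U)) → inj₂ (U , b) ≢ x
          marker≢ x∈ refl with ∈-map⁻ _ x∈
          ... | _ , _ , ()

  ∈-slots⁺ : ∀ {y} → ValidSlot y → y ∈ˡ slots
  ∈-slots⁺ {H , w , b} (conn , w∈H) = ∈-concatMap⁺ slotsOf (lose (∈-connectedSets⁺ conn)
    (∈-concatMap⁺ (slotsAt H) (lose (∈-elements⁺ w∈H) (flag b))))
    where
      flag : ∀ b → (H , w , b) ∈ˡ slotsAt H w
      flag true  = here refl
      flag false = there (here refl)

  ∈-slots⁻ : ∀ {y} → y ∈ˡ slots → ValidSlot y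
  ∈-slots⁻ y∈ with find (∈-concatMap⁻ slotsOf {xs = connectedSets G dec} y∈)
  ... | H , H∈ , y∈H with ∈-slotsOf⁻ {H} y∈H
  ...   | refl , w∈H = ∈-connectedSets⁻ H∈ , w∈H

  unique-slots : Unique slots
  unique-slots = unique-concatMap slotsOf unique-connectedSets
    (λ H → unique-concatMap (slotsAt H) (unique-elements H)
             (λ w → ((λ ()) ∷ []) ∷ [] ∷ []) λ z∈ z∈′ → trans (at z∈) (≡.sym (at z∈′)))
    λ {H} {H′} z∈ z∈′ → trans (proj₁ (∈-slotsOf⁻ {H} z∈)) (≡.sym (proj₁ (∈-slotsOf⁻ {H′} z∈′)))
    where
      at : ∀ {H w z} → z ∈ˡ slotsAt H w → w ≡ proj₁ (proj₂ z)
      at (here refl)         = refl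
      at (there (here refl)) = refl

  -- Each `U` contributes two markers, `n ∸ ∣ U ∣` pairs and its own size. Adding `Sc` here and in
  -- `length-slots` turns the comparison of the two lists into the claim without subtraction.
  length-items : length items + Sc G dec ≡ (n + 2) * Nc G dec
  length-items = go (connectedSets G dec)
    where
      one : ∀ U → length (itemsOf U) + ∣ U ∣ ≡ n + 2
      one U = begin
        2 + length (map _ (elements (∁ U))) + ∣ U ∣
          ≡⟨ cong (λ k → 2 + k + ∣ U ∣) (trans (length-map _ (elements (∁ U))) (length-elements (∁ U))) ⟩
        2 + (∣ ∁ U ∣ + ∣ U ∣)    ≡⟨ cong (λ k → 2 + (k + ∣ U ∣)) (∣∁p∣≡n∸∣p∣ U) ⟩
        2 + (n ∸ ∣ U ∣ + ∣ U ∣)  ≡⟨ cong (2 +_) (m∸n+n≡m (∣p∣≤n U)) ⟩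
        2 + n                    ≡⟨ +-comm 2 n ⟩
        n + 2                    ∎
        where open ≡.≡-Reasoning

      go : ∀ Us → length (concatMap itemsOf Us) + sum (map ∣_∣ Us) ≡ (n + 2) * length Us
      go []       = ≡.sym (*-zeroʳ (n + 2))
      go (U ∷ Us) = begin
        length (itemsOf U ++ concatMap itemsOf Us) + (∣ U ∣ + sum (map ∣_∣ Us))
          ≡⟨ cong (_+ (∣ U ∣ + sum (map ∣_∣ Us))) (length-++ (itemsOf U)) ⟩
        (length (itemsOf U) + length (concatMap itemsOf Us)) + (∣ U ∣ + sum (map ∣_∣ Us))
          ≡⟨ solve 4 (λ a b c d → (a :+ b) :+ (c :+ d) := (a :+ c) :+ (b :+ d)) refl
               (length (itemsOf U)) (length (concatMap itemsOf Us)) ∣ U ∣ (sum (map ∣_∣ Us)) ⟩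
        (length (itemsOf U) + ∣ U ∣) + (length (concatMap itemsOf Us) + sum (map ∣_∣ Us))
          ≡⟨ cong₂ _+_ (one U) (go Us) ⟩
        (n + 2) + (n + 2) * length Us
          ≡⟨ *-suc (n + 2) (length Us) ⟨
        (n + 2) * suc (length Us) ∎
        where open ≡.≡-Reasoning

  length-slots : length slots + Sc G dec ≡ 3 * Sc G dec
  length-slots = trans (cong (_+ Sc G dec) (go (connectedSets G dec)))
    (solve 1 (λ s → con 2 :* s :+ s := con 3 :* s) refl (Sc G dec))
    where
      one : ∀ H ws → length (concatMap (slotsAt H) ws) ≡ 2 * length ws
      one H []       = refl
      one H (w ∷ ws) = trans (cong (2 +_) (one H ws)) (≡.sym (*-suc 2 (length ws)))

      go : ∀ Us → length (concatMap slotsOf Us) ≡ 2 * sum (map ∣_∣ Us)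
      go []       = refl
      go (U ∷ Us) = begin
        length (slotsOf U ++ concatMap slotsOf Us)         ≡⟨ length-++ (slotsOf U) ⟩
        length (slotsOf U) + length (concatMap slotsOf Us)
          ≡⟨ cong₂ _+_ (trans (one U (elements U)) (cong (2 *_) (length-elements U))) (go Us) ⟩
        2 * ∣ U ∣ + 2 * sum (map ∣_∣ Us)                   ≡⟨ *-distribˡ-+ 2 ∣ U ∣ (sum (map ∣_∣ Us)) ⟨
        2 * (∣ U ∣ + sum (map ∣_∣ Us))                     ∎
        where open ≡.≡-Reasoning

  -- The injection from items to slots, and the lower bound

  side : Subset n → Fin n → Subset n → Bool
  -- The reference vertex `m` depends only on `H ∖ w`, so different `U` are tested at the same
  -- vertex. The default `true` never concerns a leg, whose `U` is a nonempty subset of `H ∖ w`.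
  side H w U with nonempty? (H ∖ w)
  ... | yes (m , _) = lookup U m
  ... | no _        = true

  leg-⊆-∖ : ∀ {U H w v} → Leg {G = G} U H w v → U ⊆ H ∖ w
  leg-⊆-∖ leg u∈ = ∈-∖⁺ (leg-⊆ leg u∈) (λ { refl → leg-attach∉ leg u∈ })

  -- At most two components of H ∖ w can serve as U, so one bit tells them apart.
  side-injective : ∀ {U U′ H w v v′} → ConnectedSet G U → ConnectedSet G U′ →
    Leg U H w v → Leg U′ H w v′ → side H w U ≡ side H w U′ → U ≡ U′
  side-injective {U} {U′} {H} {w} conn conn′ leg leg′ eq with nonempty? (H ∖ w)
  ... | no empty = contradiction (_ , leg-⊆-∖ leg (proj₂ (leg-nonempty leg))) empty
  ... | yes (m , m∈) with m ∈? U
  ...   | yes m∈U = leg-common⇒≡ conn conn′ leg leg′ m∈U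
                      (Vec.lookup⇒[]= m U′ (trans (≡.sym eq) (Vec.[]=⇒lookup m∈U)))
  ...   | no m∉U  =
    let m∈H , m≢w = ∈-∖⁻ m∈
        m∉U′ = λ m∈U′ → m∉U (Vec.lookup⇒[]= m U (trans eq (Vec.[]=⇒lookup m∈U′)))
    in ⊆-antisym (leg-avoid⇒⊆ leg′ leg m∈H m≢w m∉U′ m∉U) (leg-avoid⇒⊆ leg leg′ m∈H m≢w m∉U m∉U′)

  -- If `H ∖ w` is connected, its component `U` is all of it and contains the reference vertex. This
  -- leaves the slot with bit `false` free for a marker.
  side-nonCut : ∀ {U H w v} → Leg U H w v → ConnectedSet G (H ∖ w) → side H w U ≡ true
  side-nonCut {U} {H} {w} leg (_ , conn) with nonempty? (H ∖ w)
  ... | no _         = refl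
  ... | yes (m , m∈) = Vec.[]=⇒lookup (leg-⊆-component leg (proj₁ ∘ ∈-∖⁻) (λ w∈ → proj₂ (∈-∖⁻ w∈) refl)
                         conn (proj₂ (leg-nonempty leg)) (leg-⊆-∖ leg (proj₂ (leg-nonempty leg))) m∈)

  TwoEnds : Subset n → Set
  TwoEnds H = ∃₂ λ a b → a ∈ H × b ∈ H × a ≢ b × ConnectedSet G (H ∖ a) × ConnectedSet G (H ∖ b)

  twoEnds? : ∀ H → Dec (TwoEnds H)
  twoEnds? H = any? λ a → any? λ b →
    a ∈? H ×-dec b ∈? H ×-dec ¬? (a ≟ b) ×-dec dec (H ∖ a) ×-dec dec (H ∖ b)

  -- No leg reaches the slots (H , w , false) with H ∖ w connected; the two markers of H go there.
  -- Without two such w, H is a single vertex, and the markers take both of its slots.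
  Marker : Subset n → Bool → Fin n → Bool → Set
  Marker H t w c with twoEnds? H
  ... | yes (a , b , _) = w ≡ (if t then a else b) × c ≡ false
  ... | no _            = w ∈ H × c ≡ t

  marker-exists : ∀ {H} t → ConnectedSet G H → ∃₂ λ w c → w ∈ H × Marker H t w c
  marker-exists {H} t ((x , x∈H) , _) with twoEnds? H
  marker-exists {H} true  _            | yes (a , b , a∈H , b∈H , _) = a , false , a∈H , refl , refl
  marker-exists {H} false _            | yes (a , b , a∈H , b∈H , _) = b , false , b∈H , refl , refl
  marker-exists {H} t ((x , x∈H) , _)  | no _ = x , t , x∈H , x∈H , refl

  marker-injective : ∀ {H t t′ w c} → Marker H t w c → Marker H t′ w c → t ≡ t′
  marker-injective {H} m m′ with twoEnds? H
  marker-injective {t = true}  {true}  _ _ | yes _ = refl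
  marker-injective {t = true}  {false} (refl , _) (eq , _) | yes (_ , _ , _ , _ , a≢b , _) =
    contradiction eq a≢b
  marker-injective {t = false} {true}  (refl , _) (eq , _) | yes (_ , _ , _ , _ , a≢b , _) =
    contradiction (≡.sym eq) a≢b
  marker-injective {t = false} {false} _ _ | yes _ = refl
  marker-injective (_ , eq) (_ , eq′) | no _ = trans (≡.sym eq) eq′

  -- With two ends, the marker has bit `false` at a vertex where every leg has bit `true`. Without
  -- them there is no leg: `w` and a vertex of `U` would be two vertices of `H`, and `two-nonCut`
  -- would supply ends.
  marker-not-leg : ∀ {U H t w v c} → ConnectedSet G H → Leg {G = G} U H w v → side H w U ≡ c → ¬ Marker H t w c
  marker-not-leg {U} {H} conn leg eq m with twoEnds? H
  marker-not-leg {t = true} conn leg eq (refl , refl) | yes (_ , _ , _ , _ , _ , conn-a , _)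
    with trans (≡.sym eq) (side-nonCut leg conn-a)
  ... | ()
  marker-not-leg {t = false} conn leg eq (refl , refl) | yes (_ , _ , _ , _ , _ , _ , conn-b)
    with trans (≡.sym eq) (side-nonCut leg conn-b)
  ... | ()
  marker-not-leg conn leg eq m | no ¬ends with leg-nonempty leg
  ... | u , u∈U = ¬ends (two-nonCut conn (leg-⊆ leg u∈U) (leg-attach∈ leg) (λ { refl → leg-attach∉ leg u∈U }))

  Occupies : Item → Slot → Set
  Occupies (inj₁ (U , v)) (H , w , c)  = Leg {G = G} U H w v × side H w U ≡ c
  Occupies (inj₂ (H′ , t)) (H , w , c) = H′ ≡ H × Marker H t w c

  occupies-total : Connected G → Total Occupies items slots
  occupies-total G-conn {inj₁ (U , v)} x∈ =
    let conn , v∉U  = ∈-items⁻ x∈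
        H , w , leg = leg-exists G-conn conn v∉U
    in (H , w , side H w U) , ∈-slots⁺ (leg-connected conn leg , leg-attach∈ leg) , leg , refl
  occupies-total G-conn {inj₂ (H , t)} x∈ =
    let conn            = ∈-items⁻ x∈
        w , c , w∈H , m = marker-exists t conn
    in (H , w , c) , ∈-slots⁺ (conn , w∈H) , refl , m

  -- For two legs in one slot, the bit recovers `U`, and then the tip recovers `v`.
  occupies-injective : Injective Occupies items
  occupies-injective {inj₁ (U , v)} {inj₁ (U′ , v′)} x∈ x∈′ (leg , eq) (leg′ , eq′)
    with side-injective (proj₁ (∈-items⁻ x∈)) (proj₁ (∈-items⁻ x∈′)) leg leg′ (trans eq (≡.sym eq′))
  ... | refl = cong (λ v → inj₁ (U , v)) (leg-tip-unique leg leg′)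
  occupies-injective {inj₁ _} {inj₂ _} x∈ x∈′ (leg , eq) (refl , m) =
    contradiction m (marker-not-leg (∈-items⁻ x∈′) leg eq)
  occupies-injective {inj₂ _} {inj₁ _} x∈ x∈′ (refl , m) (leg , eq) =
    contradiction m (marker-not-leg (∈-items⁻ x∈) leg eq)
  occupies-injective {inj₂ _} {inj₂ _} x∈ x∈′ (refl , m) (refl , m′) =
    cong (λ t → inj₂ (_ , t)) (marker-injective m m′)

  lower-bound : Connected G → (n + 2) * Nc G dec ≤ 3 * Sc G dec
  lower-bound G-conn = begin
    (n + 2) * Nc G dec          ≡⟨ length-items ⟨
    length items + Sc G dec     ≤⟨ +-monoˡ-≤ (Sc G dec) (injective⇒length≤ Occupies unique-items
                                     (occupies-total G-conn) occupies-injective) ⟩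
    length slots + Sc G dec     ≡⟨ length-slots ⟩
    3 * Sc G dec                ∎
    where open ≤-Reasoning

  Nc>0 : Connected G → 0 < Nc G dec
  Nc>0 G-conn = ∈-length (∈-connectedSets⁺ G-conn)

  strict-bound : Connected G → n * Nc G dec < 3 * Sc G dec
  strict-bound G-conn = begin-strict
    n * Nc G dec        <⟨ *-monoˡ-< (Nc G dec) {{>-nonZero (Nc>0 G-conn)}} (m<m+n n (s≤s z≤n)) ⟩
    (n + 2) * Nc G dec  ≤⟨ lower-bound G-conn ⟩
    3 * Sc G dec        ∎
    where open ≤-Reasoning

  -- Under equality the two lists have the same length, so the injection of items into slots misses
  -- no slot.
  equality⇒occupied : Connected G → (n + 2) * Nc G dec ≡ 3 * Sc G dec →
    ∀ {y} → ValidSlot y → ∃ λ x → ValidItem x × Occupies x y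
  equality⇒occupied G-conn eq y-valid =
    let x , x∈ , occ = injective⇒surjective Occupies unique-items (occupies-total G-conn)
                         occupies-injective lengths (∈-slots⁺ y-valid)
    in x , ∈-items⁻ x∈ , occ
    where
      lengths : length items ≡ length slots
      lengths = +-cancelʳ-≡ (Sc G dec) _ _ (trans length-items (trans eq (≡.sym length-slots)))

-- Building a path from degree conditions

injective⇒permutation : (f : Fin n → Fin n) → (∀ {x y} → f x ≡ f y → x ≡ y) →
  ∃ λ (σ : Permutation′ n) → ∀ x → σ ⟨$⟩ʳ x ≡ f x
injective⇒permutation {n} f f-inj =
  permutation f (proj₁ ∘ preimage) (proj₂ ∘ preimage) (f-inj ∘ proj₂ ∘ preimage ∘ f) , λ _ → refl
  where
    preimage : ∀ y → ∃ λ x → f x ≡ y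
    preimage y =
      let x , _ , fx≡y = injective⇒surjective (λ x y → f x ≡ y) (Unique.allFin⁺ n)
            (λ _ → _ , ∈-allFin _ , refl) (λ _ _ e e′ → f-inj (trans e (≡.sym e′))) refl (∈-allFin y)
      in x , fx≡y

Consecutive : ℕ → ℕ → Set
Consecutive i j = suc i ≡ j ⊎ suc j ≡ i

module _ (G : Graph n) where

  -- An initial segment H of a path through G, ending in tip; only tip may have neighbours outside H.
  record Segment (H : Subset n) : Set where
    field
      pos          : Fin n → ℕ
      tip          : Fin n
      tip∈         : tip ∈ H
      pos-injective : ∀ {u v} → u ∈ H → v ∈ H → pos u ≡ pos v → u ≡ v
      pos≤tip      : ∀ {u} → u ∈ H → pos u ≤ pos tip
      tip<         : pos tip < ∣ H ∣
      adjacent⇔    : ∀ {u v} → u ∈ H → v ∈ H → Adjacent G u v ⇔ Consecutive (pos u) (pos v)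
      saturated    : ∀ {u v} → u ∈ H → u ≢ tip → Adjacent G u v → v ∈ H
      tip-free     : ∀ {a b} → a ∉ H → b ∉ H → Adjacent G a tip → Adjacent G b tip → a ≡ b

  -- `z` is the only neighbour of the old tip outside `H`, so the old tip becomes saturated. As the
  -- old tip is one of at most two neighbours of `z`, at most one neighbour of `z` lies beyond.
  extend-segment : ∀ {H z} → (∀ z → AtMostTwo {G = G} (λ a → Adjacent G a z)) → (s : Segment H) →
    z ∉ H → Adjacent G (Segment.tip s) z → Segment (H ⊹ z)
  extend-segment {H} {z} degree≤2 s z∉H tz = record
    { pos           = pos′
    ; tip           = z
    ; tip∈          = ∈-⊹
    ; pos-injective = λ u∈ v∈ → pos′-injective (∈-⊹⁻ u∈) (∈-⊹⁻ v∈)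
    ; pos≤tip       = λ {u} u∈ → subst (pos′ u ≤_) (≡.sym pos′-new) (pos′≤ (∈-⊹⁻ u∈))
    ; tip<          = subst (_< ∣ H ⊹ z ∣) (≡.sym pos′-new)
                        (≤-trans (s≤s tip<) (p⊂q⇒∣p∣<∣q∣ (⊆-⊹ , z , ∈-⊹ , z∉H)))
    ; adjacent⇔     = λ u∈ v∈ → adjacent⇔′ (∈-⊹⁻ u∈) (∈-⊹⁻ v∈)
    ; saturated     = λ u∈ → saturated′ (∈-⊹⁻ u∈)
    ; tip-free      = λ a∉ b∉ az bz → tip-free′ (a∉ ∘ ⊆-⊹) (b∉ ∘ ⊆-⊹) az bz
    }
    where
      open Segment s

      pos′ : Fin n → ℕ
      pos′ u with u ≟ z
      ... | yes _ = suc (pos tip)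
      ... | no _  = pos u

      pos′-new : pos′ z ≡ suc (pos tip)
      pos′-new with z ≟ z
      ... | yes _  = refl
      ... | no z≢z = contradiction refl z≢z

      pos′-old : ∀ {u} → u ∈ H → pos′ u ≡ pos u
      pos′-old {u} u∈ with u ≟ z
      ... | yes refl = contradiction u∈ z∉H
      ... | no _     = refl

      pos′≤ : ∀ {u} → u ∈ H ⊎ u ≡ z → pos′ u ≤ suc (pos tip)
      pos′≤ (inj₁ u∈) rewrite pos′-old u∈ = m≤n⇒m≤1+n (pos≤tip u∈)
      pos′≤ (inj₂ refl) = ≤-reflexive pos′-new

      pos′-injective : ∀ {u v} → u ∈ H ⊎ u ≡ z → v ∈ H ⊎ v ≡ z → pos′ u ≡ pos′ v → u ≡ v
      pos′-injective (inj₁ u∈) (inj₁ v∈) e rewrite pos′-old u∈ | pos′-old v∈ = pos-injective u∈ v∈ e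
      pos′-injective (inj₁ u∈) (inj₂ refl) e rewrite pos′-old u∈ | pos′-new =
        contradiction (subst (_≤ pos tip) e (pos≤tip u∈)) 1+n≰n
      pos′-injective (inj₂ refl) (inj₁ v∈) e rewrite pos′-old v∈ | pos′-new =
        contradiction (subst (_≤ pos tip) (≡.sym e) (pos≤tip v∈)) 1+n≰n
      pos′-injective (inj₂ refl) (inj₂ refl) _ = refl

      only-tip : ∀ {u} → u ∈ H → Adjacent G u z → u ≡ tip
      only-tip {u} u∈ uz with u ≟ tip
      ... | yes u≡tip = u≡tip
      ... | no u≢tip  = contradiction (saturated u∈ u≢tip uz) z∉H

      tip≡ : ∀ {u} → u ∈ H → Consecutive (pos u) (suc (pos tip)) → u ≡ tip
      tip≡ u∈ (inj₁ e) = pos-injective u∈ tip∈ (suc-injective e)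
      -- Here `pos u` would be `pos tip + 2`, beyond the largest position on the segment.
      tip≡ u∈ (inj₂ e) = contradiction (≤-trans (≤-reflexive e) (pos≤tip u∈)) (1+n≰n ∘ <⇒≤)

      adjacent-z⇔ : ∀ {u} → u ∈ H → Adjacent G u z ⇔ Consecutive (pos u) (suc (pos tip))
      adjacent-z⇔ u∈ = mk⇔ (λ uz → inj₁ (cong (suc ∘ pos) (only-tip u∈ uz)))
                           (λ c → subst (λ u → Adjacent G u z) (≡.sym (tip≡ u∈ c)) tz)

      adjacent⇔′ : ∀ {u v} → u ∈ H ⊎ u ≡ z → v ∈ H ⊎ v ≡ z →
        Adjacent G u v ⇔ Consecutive (pos′ u) (pos′ v)
      adjacent⇔′ (inj₁ u∈) (inj₁ v∈) rewrite pos′-old u∈ | pos′-old v∈ = adjacent⇔ u∈ v∈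
      adjacent⇔′ (inj₁ u∈) (inj₂ refl) rewrite pos′-old u∈ | pos′-new = adjacent-z⇔ u∈
      adjacent⇔′ (inj₂ refl) (inj₁ v∈) rewrite pos′-old v∈ | pos′-new =
        mk⇔ (swap ∘ Equivalence.to (adjacent-z⇔ v∈) ∘ Adjacent-sym {G = G})
            (Adjacent-sym {G = G} ∘ Equivalence.from (adjacent-z⇔ v∈) ∘ swap)
      adjacent⇔′ (inj₂ refl) (inj₂ refl) =
        mk⇔ (λ zz → contradiction zz (Adjacent-irrefl {G = G})) λ c → ⊥-elim ([ 1+n≢n , 1+n≢n ]′ c)

      saturated′ : ∀ {u v} → u ∈ H ⊎ u ≡ z → u ≢ z → Adjacent G u v → v ∈ H ⊹ z
      saturated′ (inj₂ u≡z) u≢z _ = contradiction u≡z u≢z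
      saturated′ {u} {v} (inj₁ u∈) _ uv with u ≟ tip
      ... | no u≢tip = ⊆-⊹ (saturated u∈ u≢tip uv)
      ... | yes refl with v ∈? H
      ...   | yes v∈ = ⊆-⊹ v∈
      ...   | no v∉ with tip-free v∉ z∉H (Adjacent-sym {G = G} uv) (Adjacent-sym {G = G} tz)
      ...     | refl = ∈-⊹

      tip-free′ : ∀ {a b} → a ∉ H → b ∉ H → Adjacent G a z → Adjacent G b z → a ≡ b
      tip-free′ a∉ b∉ az bz with degree≤2 z az bz tz
      ... | inj₁ a≡b         = a≡b
      ... | inj₂ (inj₁ refl) = contradiction tip∈ b∉
      ... | inj₂ (inj₂ refl) = contradiction tip∈ a∉

  start-segment : ∀ s → (∀ {a b} → Adjacent G a s → Adjacent G b s → a ≡ b) → Segment ⁅ s ⁆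
  start-segment s degree≤1 = record
    { pos           = λ _ → 0
    ; tip           = s
    ; tip∈          = x∈⁅x⁆ s
    ; pos-injective = λ u∈ v∈ _ → both u∈ v∈
    ; pos≤tip       = λ _ → z≤n
    ; tip<          = subst (0 <_) (≡.sym (∣⁅x⁆∣≡1 s)) ≤-refl
    ; adjacent⇔     = λ u∈ v∈ →
        mk⇔ (λ uv → contradiction (subst (λ x → Adjacent G x _) (both u∈ v∈) uv) (Adjacent-irrefl {G = G}))
            λ { (inj₁ ()) ; (inj₂ ()) }
    ; saturated     = λ u∈ u≢s _ → contradiction (x∈⁅y⁆⇒x≡y s u∈) u≢s
    ; tip-free      = λ _ _ → degree≤1
    }
    where
      both : ∀ {u v} → u ∈ ⁅ s ⁆ → v ∈ ⁅ s ⁆ → u ≡ v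
      both u∈ v∈ = trans (x∈⁅y⁆⇒x≡y s u∈) (≡.sym (x∈⁅y⁆⇒x≡y s v∈))

  -- A vertex missed by `H` forces an edge leaving `H`; by `saturated` it starts at the tip, and the
  -- segment grows along it.
  spanning-segment : Connected G → (∀ z → AtMostTwo {G = G} (λ a → Adjacent G a z)) →
    ∀ {H} → Segment H → ∃ λ H → Segment H × (∀ z → z ∈ H)
  spanning-segment (_ , conn) degree≤2 {H} = go (⊃-wellFounded H)
    where
      go : ∀ {H} → Acc _⊃_ H → Segment H → ∃ λ H → Segment H × (∀ z → z ∈ H)
      go {H} (acc rec) s with any? (λ y → ¬? (y ∈? H))
      ... | no all-in = H , s , λ z → decidable-stable (z ∈? H) (λ z∉ → all-in (z , z∉))
      ... | yes (y , y∉H) with crossing H (conn (Segment.tip s) y ∈⊤ ∈⊤) (Segment.tip∈ s) y∉H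
      ...   | a , b , a∈H , _ , b∉H , ab with a ≟ Segment.tip s
      ...     | no a≢tip = contradiction (Segment.saturated s a∈H a≢tip ab) b∉H
      ...     | yes refl = go (rec (⊆-⊹ , b , ∈-⊹ , b∉H)) (extend-segment degree≤2 s b∉H ab)

  -- On a spanning segment the positions are injective and below `n`, hence form a permutation.
  degrees⇒path : Connected G → (∀ z → AtMostTwo {G = G} (λ a → Adjacent G a z)) →
    ∀ s → (∀ {a b} → Adjacent G a s → Adjacent G b s → a ≡ b) → IsPath G
  degrees⇒path G-conn degree≤2 s degree≤1 with spanning-segment G-conn degree≤2 (start-segment s degree≤1)
  ... | H , seg , all-in = σ , λ u v →
    subst₂ (λ i j → Adjacent G u v ⇔ Consecutive i j) (pos≡ u) (pos≡ v) (adjacent⇔ (all-in u) (all-in v))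
    where
      open Segment seg

      pos<n : ∀ u → pos u < n
      pos<n u = ≤-trans (s≤s (pos≤tip (all-in u))) (≤-trans tip< (∣p∣≤n H))

      f : Fin n → Fin n
      f u = fromℕ< (pos<n u)

      f-inj : ∀ {u v} → f u ≡ f v → u ≡ v
      f-inj {u} {v} e = pos-injective (all-in u) (all-in v)
        (trans (≡.sym (toℕ-fromℕ< (pos<n u))) (trans (cong toℕ e) (toℕ-fromℕ< (pos<n v))))

      σ : Permutation′ n
      σ = proj₁ (injective⇒permutation f f-inj)

      pos≡ : ∀ u → pos u ≡ toℕ (σ ⟨$⟩ʳ u)
      pos≡ u = trans (≡.sym (toℕ-fromℕ< (pos<n u)))
                     (cong toℕ (≡.sym (proj₂ (injective⇒permutation f f-inj) u)))

  -- Equality forces a path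

  module _ (dec : ∀ U → Dec (ConnectedSet G U)) where

    -- When `H` has two ends, its markers sit only at the chosen two, so under equality both slots
    -- at any other vertex of `H` are taken by pairs.
    markers-at-ends : ∀ H → ¬ TwoEnds G dec H ⊎
      ∃₂ λ a b → ∀ {t w c} → Marker G dec H t w c → w ≡ a ⊎ w ≡ b
    markers-at-ends H with twoEnds? G dec H
    ... | no ¬ends        = inj₁ ¬ends
    ... | yes (a , b , _) = inj₂ (a , b , λ { {true} (w≡a , _) → inj₁ w≡a ; {false} (w≡b , _) → inj₂ w≡b })

    equality⇒path : Connected G → (n + 2) * Nc G dec ≡ 3 * Sc G dec → IsPath G
    equality⇒path G-conn@((s , _) , _) eq with markers-at-ends ⊤
    -- Two distinct vertices would give two ends by `two-nonCut`, so `G` is a single vertex.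
    ... | inj₁ ¬ends = degrees⇒path G-conn (λ _ _ _ _ → inj₁ (all≡ _ _)) s (λ _ _ → all≡ _ _)
      where
        all≡ : ∀ x y → x ≡ y
        all≡ x y = decidable-stable (x ≟ y) (λ x≢y → ¬ends (two-nonCut G-conn ∈⊤ ∈⊤ x≢y))
    ... | inj₂ (a , b , at-end) with any? (λ w → ¬? (w ≟ a) ×-dec ¬? (w ≟ b))
    -- Every vertex is `a` or `b`, so the degree conditions follow by pigeonhole.
    ...   | no ¬third = degrees⇒path G-conn (λ z _ _ _ → pigeonhole _ _ _) a
                          (λ xa ya → trans (b-only xa) (≡.sym (b-only ya)))
      where
        a-or-b : ∀ x → x ≡ a ⊎ x ≡ b
        a-or-b x with x ≟ a | x ≟ b
        ... | yes x≡a | _       = inj₁ x≡a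
        ... | no _    | yes x≡b = inj₂ x≡b
        ... | no x≢a  | no x≢b  = contradiction (x , x≢a , x≢b) ¬third

        b-only : ∀ {x} → Adjacent G x a → x ≡ b
        b-only {x} xa with a-or-b x
        ... | inj₁ refl = contradiction xa (Adjacent-irrefl {G = G})
        ... | inj₂ x≡b  = x≡b

        pigeonhole : ∀ x y z → x ≡ y ⊎ y ≡ z ⊎ x ≡ z
        pigeonhole x y z with a-or-b x | a-or-b y | a-or-b z
        ... | inj₁ e | inj₁ e′ | _       = inj₁ (trans e (≡.sym e′))
        ... | inj₂ e | inj₂ e′ | _       = inj₁ (trans e (≡.sym e′))
        ... | _      | inj₁ e  | inj₁ e′ = inj₂ (inj₁ (trans e (≡.sym e′)))
        ... | _      | inj₂ e  | inj₂ e′ = inj₂ (inj₁ (trans e (≡.sym e′)))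
        ... | inj₁ e | _       | inj₁ e′ = inj₂ (inj₂ (trans e (≡.sym e′)))
        ... | inj₂ e | _       | inj₂ e′ = inj₂ (inj₂ (trans e (≡.sym e′)))
    -- No marker of `⊤` sits at `w`, so both its slots hold legs, and their sets `U` and `U′` have
    -- different bits.
    ...   | yes (w , w≢a , w≢b) = from-legs (leg-at true) (leg-at false)
      where
        LegAt : Bool → Set
        LegAt c = ∃₂ λ U v → ConnectedSet G U × Leg {G = G} U ⊤ w v × side G dec ⊤ w U ≡ c

        leg-at : ∀ c → LegAt c
        leg-at c with equality⇒occupied G dec G-conn eq {⊤ , w , c} (G-conn , ∈⊤)
        ... | inj₁ (U , v) , (conn , _) , leg , e = U , v , conn , leg , e
        ... | inj₂ _ , _ , refl , m = contradiction (at-end m) [ w≢a , w≢b ]′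

        from-legs : LegAt true → LegAt false → IsPath G
        from-legs (U , v , conn , leg , e) (U′ , v′ , conn′ , leg′ , e′) =
          degrees⇒path G-conn degree≤2 v (λ av bv → leg-tip-degree≤1 leg v≢w ∈⊤ ∈⊤ av bv)
          where
            disjoint : ∀ {x} → x ∈ U → x ∉ U′
            disjoint x∈ x∈′ with leg-common⇒≡ conn conn′ leg leg′ x∈ x∈′
            ... | refl with trans (≡.sym e) e′
            ...   | ()

            -- If the tip were `w`, then `U` would contain everything except `w`, leaving no room
            -- for the nonempty `U′`, which is disjoint from `U` and avoids `w`.
            v≢w : v ≢ w
            v≢w refl with leg-nonempty leg′
            ... | u′ , u′∈ with leg-trivial leg ∈⊤ (λ u′∈U → disjoint u′∈U u′∈)
            ...   | refl = leg-attach∉ leg′ u′∈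

            Missed : Fin n → Set
            Missed x = x ∉ U ⊎ x ∉ U′

            -- By disjointness each vertex lies on the path of at least one of the two legs, where
            -- degrees are under control.
            missed : ∀ x → Missed x
            missed x with x ∈? U
            ... | yes x∈ = inj₂ (disjoint x∈)
            ... | no x∉  = inj₁ x∉

            at-w : ∀ {x y} → Adjacent G x w → Adjacent G y w → x ∉ U → y ∉ U → x ≡ y
            at-w xw yw x∉ y∉ = leg-attach-degree leg ∈⊤ ∈⊤ x∉ y∉ xw yw

            at-w′ : ∀ {x y} → Adjacent G x w → Adjacent G y w → x ∉ U′ → y ∉ U′ → x ≡ y
            at-w′ xw yw x∉ y∉ = leg-attach-degree leg′ ∈⊤ ∈⊤ x∉ y∉ xw yw

            degree≤2 : ∀ z → AtMostTwo {G = G} (λ a → Adjacent G a z)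
            degree≤2 z {x} {y} {t} xz yz tz with z ≟ w
            -- Among three neighbours of `w`, two miss the same set, and `leg-attach-degree`
            -- identifies them.
            ... | yes refl with missed x | missed y | missed t
            ...   | inj₁ p | inj₁ q | _      = inj₁ (at-w xz yz p q)
            ...   | inj₂ p | inj₂ q | _      = inj₁ (at-w′ xz yz p q)
            ...   | _      | inj₁ p | inj₁ q = inj₂ (inj₁ (at-w yz tz p q))
            ...   | _      | inj₂ p | inj₂ q = inj₂ (inj₁ (at-w′ yz tz p q))
            ...   | inj₁ p | _      | inj₁ q = inj₂ (inj₂ (at-w xz tz p q))
            ...   | inj₂ p | _      | inj₂ q = inj₂ (inj₂ (at-w′ xz tz p q))
            degree≤2 z xz yz tz | no z≢w with missed z
            ...   | inj₁ z∉ = leg-degree≤2 leg ∈⊤ z∉ z≢w (∈⊤ , xz) (∈⊤ , yz) (∈⊤ , tz)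
            ...   | inj₂ z∉ = leg-degree≤2 leg′ ∈⊤ z∉ z≢w (∈⊤ , xz) (∈⊤ , yz) (∈⊤ , tz)

-- Connected sets of a path as convex sets

module _ (G : Graph n) (dec : ∀ U → Dec (ConnectedSet G U)) (σ : Permutation′ n)
  (adjacent⇔ : ∀ u v → Adjacent G u v ⇔ Consecutive (toℕ (σ ⟨$⟩ʳ u)) (toℕ (σ ⟨$⟩ʳ v))) where

  private
    place : Fin n → ℕ
    place u = toℕ (σ ⟨$⟩ʳ u)

    place-injective : ∀ {u v} → place u ≡ place v → u ≡ v
    place-injective {u} {v} e =
      trans (≡.sym (inverseˡ σ)) (trans (cong (σ ⟨$⟩ˡ_) (toℕ-injective e)) (inverseˡ σ))

    -- The path read from left to right (true) or from right to left (false).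
    Before : Bool → Fin n → Fin n → Set
    Before true  x y = place x < place y
    Before false x y = place y < place x

    before? : ∀ t x y → Dec (Before t x y)
    before? true  x y = place x <? place y
    before? false x y = place y <? place x

    before-trans : ∀ t {x y z} → Before t x y → Before t y z → Before t x z
    before-trans true  p q = <-trans p q
    before-trans false p q = <-trans q p

    before-irrefl : ∀ t {x} → ¬ Before t x x
    before-irrefl true  = <-irrefl refl
    before-irrefl false = <-irrefl refl

    before-cmp : ∀ t x y → Before t x y ⊎ x ≡ y ⊎ Before t y x
    before-cmp t x y with <-cmp (place x) (place y) | t
    ... | tri< p _ _ | true  = inj₁ p
    ... | tri< p _ _ | false = inj₂ (inj₂ p)
    ... | tri≈ _ e _ | _     = inj₂ (inj₁ (place-injective e))
    ... | tri> _ _ p | true  = inj₂ (inj₂ p)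
    ... | tri> _ _ p | false = inj₁ p

    before-side : ∀ t t′ {x y} → Before t x y → Before t′ x y → t ≡ t′
    before-side true  true  _ _ = refl
    before-side true  false p q = contradiction q (<-asym p)
    before-side false true  p q = contradiction q (<-asym p)
    before-side false false _ _ = refl

    Convex : Bool → Subset n → Set
    Convex t U = ∀ {x y z} → x ∈ U → z ∈ U → Before t x y → Before t y z → y ∈ U

    convex-flip : ∀ {U} t t′ → Convex t U → Convex t′ U
    convex-flip true  true  c                 = c
    convex-flip true  false c x∈ z∈ xy yz = c z∈ x∈ yz xy
    convex-flip false true  c x∈ z∈ xy yz = c z∈ x∈ yz xy
    convex-flip false false c                 = c

    -- Each step of a walk changes `place` by one, so the walk cannot jump over `y`.
    walk-between : ∀ {U x y z} → WalkIn G U x z → Before true x y → Before true y z → y ∈ U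
    walk-between (here _) x<y y<x = contradiction y<x (<-asym x<y)
    walk-between {y = y} (step {x} {w} _ xw p) x<y y<z with Equivalence.to (adjacent⇔ x w) xw
    ... | inj₂ e = walk-between p (<-trans (≤-reflexive e) x<y) y<z
    ... | inj₁ e with m≤n⇒m<n∨m≡n (subst (_≤ place y) e x<y)
    ...   | inj₁ w<y = walk-between p w<y y<z
    ...   | inj₂ w≡y = subst (_∈ _) (place-injective w≡y) (walk-start p)

    connected⇒convex : ∀ {U} t → InducedConnected G U → Convex t U
    connected⇒convex t conn =
      convex-flip true t (λ x∈ z∈ → walk-between (conn _ _ x∈ z∈))

    successor : ∀ {u v} → Before true u v → ∃ λ u′ → place u′ ≡ suc (place u)
    successor {u} {v} u<v = σ ⟨$⟩ˡ fromℕ< bound , trans (cong toℕ (inverseʳ σ)) (toℕ-fromℕ< bound)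
      where
        bound : suc (place u) < n
        bound = ≤-trans (s≤s u<v) (toℕ<n (σ ⟨$⟩ʳ v))

    -- Induction on the distance `k`: the vertex right after `u` is `v` itself or lies strictly
    -- between, and then convexity puts it into `U`.
    walk-up : ∀ {U} → Convex true U → ∀ k {u v} → u ∈ U → v ∈ U → place u + k ≡ place v → WalkIn G U u v
    walk-up convex zero {u} u∈ v∈ e with place-injective (trans (≡.sym (+-identityʳ (place u))) e)
    ... | refl = here u∈
    walk-up {U} convex (suc k) {u} {v} u∈ v∈ e = step u∈ uu′ (walk-up convex k u′∈ v∈ e′)
      where
        e″ : suc (place u + k) ≡ place v
        e″ = trans (≡.sym (+-suc (place u) k)) e

        u<v : Before true u v
        u<v = subst (place u <_) e″ (s≤s (m≤m+n (place u) k))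

        u′ : Fin n
        u′ = proj₁ (successor {u} {v} u<v)

        u′-place : place u′ ≡ suc (place u)
        u′-place = proj₂ (successor {u} {v} u<v)

        e′ : place u′ + k ≡ place v
        e′ = trans (cong (_+ k) u′-place) e″

        uu′ : Adjacent G u u′
        uu′ = Equivalence.from (adjacent⇔ u u′) (inj₁ (≡.sym u′-place))

        u′∈ : u′ ∈ U
        u′∈ with m≤n⇒m<n∨m≡n (subst (_≤ place v) (≡.sym u′-place) u<v)
        ... | inj₁ u′<v = convex u∈ v∈ (≤-reflexive (≡.sym u′-place)) u′<v
        ... | inj₂ u′≡v = subst (_∈ U) (≡.sym (place-injective u′≡v)) v∈

    convex⇒connected : ∀ {U} t → Convex t U → InducedConnected G U
    convex⇒connected {U} t convex u v u∈ v∈ with before-cmp true u v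
    ... | inj₁ u<v         = walk-up (convex-flip t true convex) _ u∈ v∈ (m+[n∸m]≡n (<⇒≤ u<v))
    ... | inj₂ (inj₁ refl) = here u∈
    ... | inj₂ (inj₂ v<u)  =
      walk-reverse (walk-up (convex-flip t true convex) _ v∈ u∈ (m+[n∸m]≡n (<⇒≤ v<u)))

    Last : Bool → Subset n → Fin n → Set
    Last t H v = v ∈ H × (∀ {z} → z ∈ H → z ≡ v ⊎ Before t z v)

    later? : ∀ t H x → Decidable (λ z → z ∈ H × Before t x z)
    later? t H x z = z ∈? H ×-dec before? t x z

    later-⊂ : ∀ t {H x} → x ∈ H → setOf (later? t H x) ⊂ H
    later-⊂ t {H} {x} x∈H = proj₁ ∘ later⁻ , x , x∈H , before-irrefl t ∘ proj₂ ∘ later⁻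
      where
        later⁻ : ∀ {z} → z ∈ setOf (later? t H x) → z ∈ H × Before t x z
        later⁻ = ∈-setOf⁻ (later? t H x)

    -- If some vertices of `H` come after `x`, the last of those is last in `H`; they form a proper
    -- subset, as `x` is left out.
    last-exists : ∀ t {H x} → x ∈ H → ∃ (Last t H)
    last-exists t {H} = go (⊂-wellFounded H)
      where
        go : ∀ {H x} → Acc _⊂_ H → x ∈ H → ∃ (Last t H)
        go {H} {x} (acc rec) x∈H with nonempty? (setOf (later? t H x))
        ... | no empty = x , x∈H , λ {z} z∈H → bound z z∈H
          where
            bound : ∀ z → z ∈ H → z ≡ x ⊎ Before t z x
            bound z z∈H with before-cmp t z x
            ... | inj₁ zx         = inj₂ zx
            ... | inj₂ (inj₁ z≡x) = inj₁ z≡x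
            ... | inj₂ (inj₂ xz)  = contradiction (z , ∈-setOf⁺ (later? t H x) (z∈H , xz)) empty
        ... | yes (y , y∈) with go (rec (later-⊂ t x∈H)) y∈
        ...   | v , v∈ , bound = v , proj₁ (∈-setOf⁻ (later? t H x) v∈) , λ {z} z∈H → bound′ z z∈H
          where
            xv : Before t x v
            xv = proj₂ (∈-setOf⁻ (later? t H x) v∈)

            bound′ : ∀ z → z ∈ H → z ≡ v ⊎ Before t z v
            bound′ z z∈H with before-cmp t z x
            ... | inj₁ zx           = inj₂ (before-trans t zx xv)
            ... | inj₂ (inj₁ refl)  = inj₂ xv
            ... | inj₂ (inj₂ xz)    = bound (∈-setOf⁺ (later? t H x) (z∈H , xz))

    -- The injection from slots to items on a path

    earlier? : ∀ t H w → Decidable (λ z → z ∈ H × Before t z w)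
    earlier? t H w z = z ∈? H ×-dec before? t z w

    earlier : Bool → Subset n → Fin n → Subset n
    earlier t H w = setOf (earlier? t H w)

    -- Here the bit is a direction along the path, unrelated to `side`. In each direction only the
    -- first vertex of the interval `H` cuts off nothing; these two slots match the two markers of
    -- `H`.
    Vacates : Slot G dec → Item G dec → Set
    Vacates (H , w , t) (inj₁ (U , v))   = U ≡ earlier t H w × Nonempty U × Last t H v
    Vacates (H , w , t) (inj₂ (H′ , t′)) = H ≡ H′ × t ≡ t′ × (∀ {z} → z ∈ H → ¬ Before t z w)

    vacates-total : Total Vacates (slots G dec) (items G dec)
    vacates-total {H , w , t} y∈ with ∈-slots⁻ G dec y∈ | nonempty? (earlier t H w)
    ... | H-conn , w∈H | no empty =
      inj₂ (H , t) , ∈-items⁺ G dec H-conn , refl , refl ,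
      λ z∈H zw → empty (_ , ∈-setOf⁺ (earlier? t H w) (z∈H , zw))
    ... | (_ , conn) , w∈H | yes ne with last-exists t w∈H
    ...   | v , v∈H , bound =
      inj₁ (earlier t H w , v) , ∈-items⁺ G dec ((ne , convex⇒connected t convex) , v∉) ,
      refl , ne , v∈H , bound
      where
        convex : Convex t (earlier t H w)
        convex x∈ z∈ xy yz =
          let x∈H , _  = ∈-setOf⁻ (earlier? t H w) x∈
              z∈H , zw = ∈-setOf⁻ (earlier? t H w) z∈
          in ∈-setOf⁺ (earlier? t H w)
               (connected⇒convex t conn x∈H z∈H xy yz , before-trans t yz zw)

        v∉ : v ∉ earlier t H w
        v∉ v∈ with ∈-setOf⁻ (earlier? t H w) v∈ | bound w∈H
        ... | _ , vw | inj₁ refl = before-irrefl t vw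
        ... | _ , vw | inj₂ wv   = before-irrefl t (before-trans t vw wv)

    before-last : ∀ {t H w v u} → w ∈ H → Last t H v → u ∈ earlier t H w → Before t u v
    before-last {t} {H} {w} w∈H (_ , bound) u∈ with ∈-setOf⁻ (earlier? t H w) u∈ | bound w∈H
    ... | _ , uw | inj₁ refl = uw
    ... | _ , uw | inj₂ wv   = before-trans t uw wv

    -- H is the convex hull of U and v.
    hull-⊆ : ∀ {t H H′ w w′ v} → InducedConnected G H′ → earlier t H w ≡ earlier t H′ w′ →
      Nonempty (earlier t H w) → Last t H v → Last t H′ v → H ⊆ H′
    hull-⊆ {t} {H} {H′} {w} {w′} {v} conn′ e (u , u∈) (_ , bound) (v∈H′ , _) {z} z∈H
      with before? t z w | bound z∈H
    ... | yes zw | _ = proj₁ (∈-setOf⁻ (earlier? t H′ w′) (subst (z ∈_) e (∈-setOf⁺ (earlier? t H w) (z∈H , zw))))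
    ... | no _   | inj₁ refl = v∈H′
    ... | no ¬zw | inj₂ zv   = connected⇒convex t conn′ u∈H′ v∈H′ uz zv
      where
        u∈H′ : u ∈ H′
        u∈H′ = proj₁ (∈-setOf⁻ (earlier? t H′ w′) (subst (u ∈_) e u∈))

        uw : Before t u w
        uw = proj₂ (∈-setOf⁻ (earlier? t H w) u∈)

        uz : Before t u z
        uz with before-cmp t w z
        ... | inj₁ wz          = before-trans t uw wz
        ... | inj₂ (inj₁ refl) = uw
        ... | inj₂ (inj₂ zw)   = contradiction zw ¬zw

    -- If `w` and `w′` differ, the one that comes first belongs to the part cut off by the other,
    -- but not to its own.
    earlier-injective : ∀ {t H w w′} → w ∈ H → w′ ∈ H → earlier t H w ≡ earlier t H w′ → w ≡ w′
    earlier-injective {t} {H} {w} {w′} w∈H w′∈H e with before-cmp t w w′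
    ... | inj₂ (inj₁ w≡w′) = w≡w′
    ... | inj₁ ww′         = contradiction
      (proj₂ (∈-setOf⁻ (earlier? t H w) (subst (w ∈_) (≡.sym e) (∈-setOf⁺ (earlier? t H w′) (w∈H , ww′)))))
      (before-irrefl t)
    ... | inj₂ (inj₂ w′w)  = contradiction
      (proj₂ (∈-setOf⁻ (earlier? t H w′) (subst (w′ ∈_) e (∈-setOf⁺ (earlier? t H w) (w′∈H , w′w)))))
      (before-irrefl t)

    vacates-injective : Injective Vacates (slots G dec)
    vacates-injective {H , w , t} {H′ , w′ , t′} {inj₂ _} y∈ y∈′ (refl , refl , first) (refl , refl , first′)
      with before-cmp t w w′
    ... | inj₁ ww′          = contradiction ww′ (first′ (proj₂ (∈-slots⁻ G dec y∈)))
    ... | inj₂ (inj₁ refl)  = refl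
    ... | inj₂ (inj₂ w′w)   = contradiction w′w (first (proj₂ (∈-slots⁻ G dec y∈′)))
    vacates-injective {H , w , t} {H′ , w′ , t′} {inj₁ (U , v)} y∈ y∈′
      (refl , (u , u∈) , last) (e , _ , last′)
      with ∈-slots⁻ G dec y∈ | ∈-slots⁻ G dec y∈′
    ... | (_ , conn) , w∈H | (_ , conn′) , w′∈H′
      -- A vertex `u` of `U` precedes `v` in both directions `t` and `t′`, so they agree; then `H`
      -- is recovered as a hull, and `w` from the part before it.
      with before-side t t′ (before-last {t} w∈H last u∈) (before-last {t′} w′∈H′ last′ (subst (u ∈_) e u∈))
    ...   | refl with ⊆-antisym (hull-⊆ conn′ e (u , u∈) last last′)
                                (hull-⊆ conn (≡.sym e) (u , subst (u ∈_) e u∈) last′ last)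
    ...     | refl with earlier-injective {t} w∈H w′∈H′ e
    ...       | refl = refl

  path⇒equality : Connected G → (n + 2) * Nc G dec ≡ 3 * Sc G dec
  path⇒equality G-conn = ≤-antisym (lower-bound G dec G-conn) (begin
    3 * Sc G dec                              ≡⟨ length-slots G dec ⟨
    length (slots G dec) + Sc G dec           ≤⟨ +-monoˡ-≤ (Sc G dec) (injective⇒length≤ Vacates
                                                   (unique-slots G dec) vacates-total vacates-injective) ⟩
    length (items G dec) + Sc G dec           ≡⟨ length-items G dec ⟩
    (n + 2) * Nc G dec                        ∎)
    where open ≤-Reasoning

theorem1p1 : (n : ℕ) (G : Graph n) → Connected G → (dec : ∀ U → Dec (ConnectedSet G U)) →
    ((n + 2) * Nc G dec ≤ 3 * Sc G dec)
    × (((n + 2) * Nc G dec ≡ 3 * Sc G dec) ⇔ IsPath G)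
    × (n * Nc G dec < 3 * Sc G dec)
theorem1p1 n G G-conn dec =
  lower-bound G dec G-conn ,
  mk⇔ (equality⇒path G dec G-conn) (λ (σ , adjacent⇔) → path⇒equality G dec σ adjacent⇔ G-conn) ,
  strict-bound G dec G-conn
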